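{- Let $(x_n)_{n \in \mathbb{N}}$ be a sequence in $[0,1)$ with the following property: there exist $s \in \mathbb{N}$ and positive real numbers $K$ and $\gamma$ such that for infinitely many $N$ the point set $x_1, \ldots, x_N$ has a subset $x_{j_1}, \ldots, x_{j_M}$ with $M \geq \gamma N$ elements which is contained in some finite set of points of $[0,1)$ of cardinality at most $KN$ having at most $s$ different distances between neighbouring elements (gaps). Then $(x_n)_{n \in \mathbb{N}}$ does not have Poissonian pair correlations.
   Context: For real $x$, $\|x\|$ denotes the distance from $x$ to the nearest integer. A sequence $(x_n)_{n\in\mathbb{N}}$ in $[0,1)$ has Poissonian pair correlations if for every $s \geq 0$, $$F_N(s) := \frac{1}{N}\#\left\{1 \leq l \neq m \leq N : \|x_l - x_m\| \leq \frac{s}{N}\right\} \to 2s \quad (N\to\infty).$$ For a finite point set in $[0,1)$, the gaps are the distances between neighbouring elements, i.e. between consecutive points when the set is arranged in increasing order. -}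

module Defs where

open import Data.Fin.Base using (Fin; toℕ)
open import Data.Fin.Subset using (Subset) renaming (_∈_ to _∈ₛ_; ∣_∣ to card)
open import Data.Integer.Base as ℤ using (ℤ; +_)
import Data.Integer.DivMod as ℤ
import Data.Integer.Properties as ℤ
open import Data.List.Base using (List; []; _∷_; length; filter; cartesianProduct; allFin)
open import Data.List.Membership.Propositional using (_∈_)
open import Data.List.Membership.Propositional.Properties
  using (∈-filter⁺; ∈-filter⁻; ∈-cartesianProduct⁺; ∈-allFin)
open import Data.List.Relation.Unary.All as All using (All; []; _∷_)
open import Data.List.Relation.Unary.Unique.Propositional using (Unique)
import Data.List.Relation.Unary.Unique.Propositional.Properties as Unique
open import Data.Nat.Base as ℕ using (ℕ; suc; NonZero)
import Data.Nat.Properties as ℕ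
open import Data.Product.Base using (Σ-syntax; ∃-syntax; _×_; _,_; proj₁; proj₂)
open import Data.Rational.Base as ℚ using (ℚ; 0ℚ; 1ℚ; ½)
open import Data.Rational.Literals using (fromℤ)
import Data.Rational.Properties as ℚ
open import Data.Rational.Solver using (module +-*-Solver)
open import Data.Sum.Base using (_⊎_; inj₁; inj₂; [_,_]′)
open import Function.Bundles using (_⇔_; mk⇔)
open import Level using (0ℓ)
open import Relation.Binary.PropositionalEquality
  using (_≡_; _≢_; refl; sym; trans; cong; subst; subst₂)
open import Relation.Nullary using (¬_; Dec; yes; no)
open import Relation.Unary using (Pred)

open ℚ.≤-Reasoning
open +-*-Solver using (solve; _:=_; _:+_; _:-_; _:*_; :-_)

-- Real numbers are Cauchy sequences of rationals, with _≃_ as equality.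

Cauchy : (ℕ → ℚ) → Set
Cauchy u = ∀ ε → 0ℚ ℚ.< ε →
  ∃[ N ] ∀ m n → N ℕ.≤ m → N ℕ.≤ n → ℚ.∣ u m ℚ.- u n ∣ ℚ.≤ ε

record ℝ : Set where
  constructor mkℝ
  field
    seq    : ℕ → ℚ
    cauchy : Cauchy seq

open ℝ public

infix 4 _≃_ _≤_ _<_

_≃_ : ℝ → ℝ → Set
x ≃ y = ∀ ε → 0ℚ ℚ.< ε →
  ∃[ N ] ∀ n → N ℕ.≤ n → ℚ.∣ seq x n ℚ.- seq y n ∣ ℚ.≤ ε

_≤_ : ℝ → ℝ → Set
x ≤ y = ∀ ε → 0ℚ ℚ.< ε →
  ∃[ N ] ∀ n → N ℕ.≤ n → seq x n ℚ.≤ seq y n ℚ.+ ε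

_<_ : ℝ → ℝ → Set
x < y = ∃[ ε ] 0ℚ ℚ.< ε × (∃[ N ] ∀ n → N ℕ.≤ n → seq x n ℚ.+ ε ℚ.≤ seq y n)

fromℚ : ℚ → ℝ
fromℚ q = mkℝ (λ _ → q) λ ε 0<ε → 0 , λ _ _ _ _ →
  subst (ℚ._≤ ε) (cong ℚ.∣_∣ (sym (ℚ.+-inverseʳ q))) (ℚ.<⇒≤ 0<ε)

fromℕ : ℕ → ℝ
fromℕ n = fromℚ (fromℤ (+ n))

0ℝ 1ℝ : ℝ
0ℝ = fromℚ 0ℚ
1ℝ = fromℚ 1ℚ

private
  half-pos : ∀ {ε} → 0ℚ ℚ.< ε → 0ℚ ℚ.< ½ ℚ.* ε
  half-pos {ε} 0<ε = subst (ℚ._< ½ ℚ.* ε) (ℚ.*-zeroʳ ½) (ℚ.*-monoʳ-<-pos ½ 0<ε)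

  halves : ∀ ε → ½ ℚ.* ε ℚ.+ ½ ℚ.* ε ≡ ε
  halves ε = trans (sym (ℚ.*-distribʳ-+ ε ½ ½)) (ℚ.*-identityˡ ε)

  neg-∣-∣ : ∀ p q → ℚ.∣ (ℚ.- p) ℚ.- (ℚ.- q) ∣ ≡ ℚ.∣ p ℚ.- q ∣
  neg-∣-∣ p q = trans
    (cong ℚ.∣_∣ (solve 2 (λ a b → (:- a) :- (:- b) := :- (a :- b)) refl p q))
    (ℚ.∣-p∣≡∣p∣ (p ℚ.- q))

  nonExpansive : (f : ℚ → ℚ) → (∀ p q → ℚ.∣ f p ℚ.- f q ∣ ℚ.≤ ℚ.∣ p ℚ.- q ∣) →
                 ∀ x → Cauchy (λ n → f (seq x n))
  nonExpansive f lip x ε 0<ε with cauchy x ε 0<ε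
  ... | N , h = N , λ m n N≤m N≤n → ℚ.≤-trans (lip _ _) (h m n N≤m N≤n)

infixl 6 _+_ _-_
infixl 7 _*_

_+_ : ℝ → ℝ → ℝ
x + y = mkℝ (λ n → seq x n ℚ.+ seq y n) c
  where
  regroup : ∀ a b c d → (a ℚ.+ b) ℚ.- (c ℚ.+ d) ≡ (a ℚ.- c) ℚ.+ (b ℚ.- d)
  regroup = solve 4 (λ a b c d →
    (a :+ b) :- (c :+ d) := (a :- c) :+ (b :- d)) refl

  c : Cauchy (λ n → seq x n ℚ.+ seq y n)
  c ε 0<ε with cauchy x (½ ℚ.* ε) (half-pos 0<ε) | cauchy y (½ ℚ.* ε) (half-pos 0<ε)
  ... | N₁ , h₁ | N₂ , h₂ = N₁ ℕ.⊔ N₂ , λ m n N≤m N≤n → begin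
    ℚ.∣ (seq x m ℚ.+ seq y m) ℚ.- (seq x n ℚ.+ seq y n) ∣
      ≡⟨ cong ℚ.∣_∣ (regroup (seq x m) (seq y m) (seq x n) (seq y n)) ⟩
    ℚ.∣ (seq x m ℚ.- seq x n) ℚ.+ (seq y m ℚ.- seq y n) ∣
      ≤⟨ ℚ.∣p+q∣≤∣p∣+∣q∣ (seq x m ℚ.- seq x n) (seq y m ℚ.- seq y n) ⟩
    ℚ.∣ seq x m ℚ.- seq x n ∣ ℚ.+ ℚ.∣ seq y m ℚ.- seq y n ∣
      ≤⟨ ℚ.+-mono-≤ (h₁ m n (ℕ.m⊔n≤o⇒m≤o N₁ N₂ N≤m) (ℕ.m⊔n≤o⇒m≤o N₁ N₂ N≤n))
                    (h₂ m n (ℕ.m⊔n≤o⇒n≤o N₁ N₂ N≤m) (ℕ.m⊔n≤o⇒n≤o N₁ N₂ N≤n)) ⟩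
    ½ ℚ.* ε ℚ.+ ½ ℚ.* ε
      ≡⟨ halves ε ⟩
    ε ∎

-_ : ℝ → ℝ
- x = mkℝ (λ n → ℚ.- seq x n) (nonExpansive ℚ.-_ lip x)
  where
  lip : ∀ p q → ℚ.∣ (ℚ.- p) ℚ.- (ℚ.- q) ∣ ℚ.≤ ℚ.∣ p ℚ.- q ∣
  lip p q = ℚ.≤-reflexive (neg-∣-∣ p q)

_-_ : ℝ → ℝ → ℝ
x - y = x + (- y)

private
  eventuallyBounded : ∀ x →
    ∃[ B ] 0ℚ ℚ.< B × (∃[ N ] ∀ n → N ℕ.≤ n → ℚ.∣ seq x n ∣ ℚ.≤ B)
  eventuallyBounded x with cauchy x 1ℚ (ℚ.positive⁻¹ 1ℚ)
  ... | N , h =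
    1ℚ ℚ.+ ℚ.∣ seq x N ∣ ,
    ℚ.+-mono-<-≤ (ℚ.positive⁻¹ 1ℚ) (ℚ.0≤∣p∣ (seq x N)) ,
    N , λ n N≤n → begin
      ℚ.∣ seq x n ∣
        ≡⟨ cong ℚ.∣_∣ (solve 2 (λ a b → a := (a :- b) :+ b) refl (seq x n) (seq x N)) ⟩
      ℚ.∣ (seq x n ℚ.- seq x N) ℚ.+ seq x N ∣
        ≤⟨ ℚ.∣p+q∣≤∣p∣+∣q∣ (seq x n ℚ.- seq x N) (seq x N) ⟩
      ℚ.∣ seq x n ℚ.- seq x N ∣ ℚ.+ ℚ.∣ seq x N ∣
        ≤⟨ ℚ.+-monoˡ-≤ ℚ.∣ seq x N ∣ (h n N N≤n ℕ.≤-refl) ⟩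
      1ℚ ℚ.+ ℚ.∣ seq x N ∣ ∎

  *-bound : ∀ {p q b d} → ℚ.∣ p ∣ ℚ.≤ b → ℚ.∣ q ∣ ℚ.≤ d → ℚ.∣ p ℚ.* q ∣ ℚ.≤ b ℚ.* d
  *-bound {p} {q} {b} {d} p≤b q≤d = begin
    ℚ.∣ p ℚ.* q ∣         ≡⟨ ℚ.∣p*q∣≡∣p∣*∣q∣ p q ⟩
    ℚ.∣ p ∣ ℚ.* ℚ.∣ q ∣   ≤⟨ ℚ.*-monoʳ-≤-nonNeg ℚ.∣ q ∣ {{ℚ.∣-∣-nonNeg q}} p≤b ⟩
    b ℚ.* ℚ.∣ q ∣         ≤⟨ ℚ.*-monoˡ-≤-nonNeg b {{ℚ.nonNegative 0≤b}} q≤d ⟩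
    b ℚ.* d               ∎
    where
    0≤b : 0ℚ ℚ.≤ b
    0≤b = ℚ.≤-trans (ℚ.0≤∣p∣ p) p≤b

  divide : ∀ s → 0ℚ ℚ.< s → ∀ {ε} → 0ℚ ℚ.< ε → ∃[ δ ] 0ℚ ℚ.< δ × s ℚ.* δ ≡ ε
  divide s 0<s {ε} 0<ε = r ℚ.* ε ,
    subst (ℚ._< r ℚ.* ε) (ℚ.*-zeroʳ r) (ℚ.*-monoʳ-<-pos r {{ℚ.1/pos⇒pos s}} 0<ε) ,
    trans (sym (ℚ.*-assoc s r ε)) (trans (cong (ℚ._* ε) (ℚ.*-inverseʳ s)) (ℚ.*-identityˡ ε))
    where
    instance
      s>0 : ℚ.Positive s
      s>0 = ℚ.positive 0<s

      s≢0 : ℚ.NonZero s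
      s≢0 = ℚ.pos⇒nonZero s

    r : ℚ
    r = ℚ.1/ s

  share : ∀ {a b ε} → 0ℚ ℚ.< a → 0ℚ ℚ.< b → 0ℚ ℚ.< ε →
          ∃[ δ ] 0ℚ ℚ.< δ × a ℚ.* δ ℚ.+ b ℚ.* δ ≡ ε
  share {a} {b} 0<a 0<b 0<ε =
    let δ , 0<δ , e = divide (a ℚ.+ b) 0<a+b 0<ε
    in δ , 0<δ , trans (sym (ℚ.*-distribʳ-+ δ a b)) e
    where
    0<a+b : 0ℚ ℚ.< a ℚ.+ b
    0<a+b = ℚ.<-trans 0<a (subst (ℚ._< a ℚ.+ b) (ℚ.+-identityʳ a) (ℚ.+-monoʳ-< a 0<b))

_*_ : ℝ → ℝ → ℝ
x * y = mkℝ (λ n → seq x n ℚ.* seq y n) c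
  where
  regroup : ∀ a b c d → a ℚ.* b ℚ.- c ℚ.* d ≡ a ℚ.* (b ℚ.- d) ℚ.+ d ℚ.* (a ℚ.- c)
  regroup = solve 4 (λ a b c d →
    a :* b :- c :* d := a :* (b :- d) :+ d :* (a :- c)) refl

  c : Cauchy (λ n → seq x n ℚ.* seq y n)
  c ε 0<ε =
    let A , 0<A , N₁ , hA = eventuallyBounded x
        B , 0<B , N₂ , hB = eventuallyBounded y
        δ , 0<δ , scale   = share 0<A 0<B 0<ε
        N₃ , h₃           = cauchy x δ 0<δ
        N₄ , h₄           = cauchy y δ 0<δ
    in (N₁ ℕ.⊔ N₂) ℕ.⊔ (N₃ ℕ.⊔ N₄) , λ m n N≤m N≤n →
    let m₁₂ = ℕ.m⊔n≤o⇒m≤o (N₁ ℕ.⊔ N₂) (N₃ ℕ.⊔ N₄) N≤m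
        n₁₂ = ℕ.m⊔n≤o⇒m≤o (N₁ ℕ.⊔ N₂) (N₃ ℕ.⊔ N₄) N≤n
        m₃₄ = ℕ.m⊔n≤o⇒n≤o (N₁ ℕ.⊔ N₂) (N₃ ℕ.⊔ N₄) N≤m
        n₃₄ = ℕ.m⊔n≤o⇒n≤o (N₁ ℕ.⊔ N₂) (N₃ ℕ.⊔ N₄) N≤n
    in begin
    ℚ.∣ seq x m ℚ.* seq y m ℚ.- seq x n ℚ.* seq y n ∣
      ≡⟨ cong ℚ.∣_∣ (regroup (seq x m) (seq y m) (seq x n) (seq y n)) ⟩
    ℚ.∣ seq x m ℚ.* (seq y m ℚ.- seq y n) ℚ.+ seq y n ℚ.* (seq x m ℚ.- seq x n) ∣
      ≤⟨ ℚ.∣p+q∣≤∣p∣+∣q∣ (seq x m ℚ.* (seq y m ℚ.- seq y n)) (seq y n ℚ.* (seq x m ℚ.- seq x n)) ⟩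
    ℚ.∣ seq x m ℚ.* (seq y m ℚ.- seq y n) ∣ ℚ.+ ℚ.∣ seq y n ℚ.* (seq x m ℚ.- seq x n) ∣
      ≤⟨ ℚ.+-mono-≤
           (*-bound {seq x m} {seq y m ℚ.- seq y n}
             (hA m (ℕ.m⊔n≤o⇒m≤o N₁ N₂ m₁₂))
             (h₄ m n (ℕ.m⊔n≤o⇒n≤o N₃ N₄ m₃₄) (ℕ.m⊔n≤o⇒n≤o N₃ N₄ n₃₄)))
           (*-bound {seq y n} {seq x m ℚ.- seq x n}
             (hB n (ℕ.m⊔n≤o⇒n≤o N₁ N₂ n₁₂))
             (h₃ m n (ℕ.m⊔n≤o⇒m≤o N₃ N₄ m₃₄) (ℕ.m⊔n≤o⇒m≤o N₃ N₄ n₃₄))) ⟩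
    A ℚ.* δ ℚ.+ B ℚ.* δ
      ≡⟨ scale ⟩
    ε ∎

private
  ∣-∣-swap : ∀ p q → ℚ.∣ p ℚ.- q ∣ ≡ ℚ.∣ q ℚ.- p ∣
  ∣-∣-swap p q = trans (sym (ℚ.∣-p∣≡∣p∣ (p ℚ.- q)))
    (cong ℚ.∣_∣ (solve 2 (λ a b → :- (a :- b) := b :- a) refl p q))

  ≤+⇒-≤ : ∀ {p q r} → p ℚ.≤ r ℚ.+ q → p ℚ.- q ℚ.≤ r
  ≤+⇒-≤ {p} {q} {r} h = subst (p ℚ.- q ℚ.≤_)
    (solve 2 (λ a b → (a :+ b) :- b := a) refl r q) (ℚ.+-monoˡ-≤ (ℚ.- q) h)

  ∣-∣-triangle : ∀ p q r → ℚ.∣ p ℚ.- r ∣ ℚ.≤ ℚ.∣ p ℚ.- q ∣ ℚ.+ ℚ.∣ q ℚ.- r ∣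
  ∣-∣-triangle p q r = subst (λ t → ℚ.∣ t ∣ ℚ.≤ ℚ.∣ p ℚ.- q ∣ ℚ.+ ℚ.∣ q ℚ.- r ∣)
    (solve 3 (λ a b c → (a :- b) :+ (b :- c) := a :- c) refl p q r)
    (ℚ.∣p+q∣≤∣p∣+∣q∣ (p ℚ.- q) (q ℚ.- r))

  oneSided⇒lip : (f : ℚ → ℚ) → (∀ p q → f p ℚ.≤ ℚ.∣ p ℚ.- q ∣ ℚ.+ f q) →
                 ∀ p q → ℚ.∣ f p ℚ.- f q ∣ ℚ.≤ ℚ.∣ p ℚ.- q ∣
  oneSided⇒lip f h p q = case (ℚ.∣p∣≡p∨∣p∣≡-p (f p ℚ.- f q))
    where
    case : ℚ.∣ f p ℚ.- f q ∣ ≡ f p ℚ.- f q ⊎ ℚ.∣ f p ℚ.- f q ∣ ≡ ℚ.- (f p ℚ.- f q) →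
           ℚ.∣ f p ℚ.- f q ∣ ℚ.≤ ℚ.∣ p ℚ.- q ∣
    case (inj₁ e) = subst (ℚ._≤ ℚ.∣ p ℚ.- q ∣) (sym e) (≤+⇒-≤ (h p q))
    case (inj₂ e) = subst₂ ℚ._≤_
      (trans (solve 2 (λ a b → b :- a := :- (a :- b)) refl (f p) (f q)) (sym e))
      (∣-∣-swap q p) (≤+⇒-≤ (h q p))

∣_∣ : ℝ → ℝ
∣ x ∣ = mkℝ (λ n → ℚ.∣ seq x n ∣) (nonExpansive ℚ.∣_∣ (oneSided⇒lip ℚ.∣_∣ h) x)
  where
  h : ∀ p q → ℚ.∣ p ∣ ℚ.≤ ℚ.∣ p ℚ.- q ∣ ℚ.+ ℚ.∣ q ∣
  h p q = subst (λ t → ℚ.∣ t ∣ ℚ.≤ ℚ.∣ p ℚ.- q ∣ ℚ.+ ℚ.∣ q ∣)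
    (solve 2 (λ a b → (a :- b) :+ b := a) refl p q) (ℚ.∣p+q∣≤∣p∣+∣q∣ (p ℚ.- q) q)

-- Distance to the nearest integer; see ‖‖ℚ-lower and ‖‖ℚ-attained.
‖_‖ℚ : ℚ → ℚ
‖ q ‖ℚ = ℚ.∣ q ℚ.- fromℤ (ℚ.floor q) ∣ ℚ.⊓ ℚ.∣ q ℚ.- fromℤ (ℤ.suc (ℚ.floor q)) ∣

private
  fromℤ-mono-≤ : ∀ {i j} → i ℤ.≤ j → fromℤ i ℚ.≤ fromℤ j
  fromℤ-mono-≤ i≤j = ℚ.*≤* (ℤ.*-monoʳ-≤-nonNeg (+ 1) i≤j)

  floor≤ : ∀ q → fromℤ (ℚ.floor q) ℚ.≤ q
  floor≤ q@record{} = ℚ.*≤* (subst ((ℚ.floor q) ℤ.* (ℚ.↧ q) ℤ.≤_)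
    (sym (ℤ.*-identityʳ (ℚ.↥ q))) (ℤ.[n/d]*d≤n (ℚ.↥ q) (ℚ.↧ q)))

  ≤floor+1 : ∀ q → q ℚ.≤ fromℤ (ℤ.suc (ℚ.floor q))
  ≤floor+1 q@record{} = ℚ.*≤* (subst₂ ℤ._≤_ (sym (ℤ.*-identityʳ (ℚ.↥ q)))
    (cong (λ i → ℤ.suc i ℤ.* (ℚ.↧ q)) (sym (ℤ.div-pos-is-/ℕ (ℚ.↥ q) (ℚ.↧ₙ q))))
    (ℤ.<⇒≤ (ℤ.n<s[n/ℕd]*d (ℚ.↥ q) (ℚ.↧ₙ q))))

  ordered-∣-∣ : ∀ {p q r} → p ℚ.≤ q → q ℚ.≤ r → ℚ.∣ r ℚ.- q ∣ ℚ.≤ ℚ.∣ r ℚ.- p ∣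
  ordered-∣-∣ {p} {q} {r} p≤q q≤r = subst₂ ℚ._≤_
    (sym (ℚ.0≤p⇒∣p∣≡p (0≤ q≤r))) (sym (ℚ.0≤p⇒∣p∣≡p (0≤ (ℚ.≤-trans p≤q q≤r))))
    (ℚ.+-monoʳ-≤ r (ℚ.neg-antimono-≤ p≤q))
    where
    0≤ : ∀ {a b} → a ℚ.≤ b → 0ℚ ℚ.≤ b ℚ.- a
    0≤ {a} {b} a≤b = subst (ℚ._≤ b ℚ.- a) (ℚ.+-inverseʳ a) (ℚ.+-monoˡ-≤ (ℚ.- a) a≤b)

  ordered-∣-∣′ : ∀ {p q r} → p ℚ.≤ q → q ℚ.≤ r → ℚ.∣ p ℚ.- q ∣ ℚ.≤ ℚ.∣ p ℚ.- r ∣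
  ordered-∣-∣′ {p} {q} {r} p≤q q≤r = subst₂ ℚ._≤_
    (neg-∣-∣ p q) (neg-∣-∣ p r)
    (ordered-∣-∣ (ℚ.neg-antimono-≤ q≤r) (ℚ.neg-antimono-≤ p≤q))

‖‖ℚ-lower : ∀ q i → ‖ q ‖ℚ ℚ.≤ ℚ.∣ q ℚ.- fromℤ i ∣
‖‖ℚ-lower q i = case (i ℤ.≤? ℚ.floor q)
  where
  d₀ d₁ : ℚ
  d₀ = ℚ.∣ q ℚ.- fromℤ (ℚ.floor q) ∣
  d₁ = ℚ.∣ q ℚ.- fromℤ (ℤ.suc (ℚ.floor q)) ∣

  case : Dec (i ℤ.≤ ℚ.floor q) → ‖ q ‖ℚ ℚ.≤ ℚ.∣ q ℚ.- fromℤ i ∣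
  case (yes i≤f) = ℚ.≤-trans (ℚ.p⊓q≤p d₀ d₁) (ordered-∣-∣ (fromℤ-mono-≤ i≤f) (floor≤ q))
  case (no i≰f)  = ℚ.≤-trans (ℚ.p⊓q≤q d₀ d₁)
    (ordered-∣-∣′ (≤floor+1 q) (fromℤ-mono-≤ (ℤ.i<j⇒suc[i]≤j (ℤ.≰⇒> i≰f))))

‖‖ℚ-attained : ∀ q → ∃[ i ] ‖ q ‖ℚ ≡ ℚ.∣ q ℚ.- fromℤ i ∣
‖‖ℚ-attained q = [ (λ e → ℚ.floor q , e) , (λ e → ℤ.suc (ℚ.floor q) , e) ]′
  (ℚ.⊓-sel ℚ.∣ q ℚ.- fromℤ (ℚ.floor q) ∣ ℚ.∣ q ℚ.- fromℤ (ℤ.suc (ℚ.floor q)) ∣)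

‖_‖ : ℝ → ℝ
‖ x ‖ = mkℝ (λ n → ‖ seq x n ‖ℚ) (nonExpansive ‖_‖ℚ (oneSided⇒lip ‖_‖ℚ h) x)
  where
  h : ∀ p q → ‖ p ‖ℚ ℚ.≤ ℚ.∣ p ℚ.- q ∣ ℚ.+ ‖ q ‖ℚ
  h p q = let i , e = ‖‖ℚ-attained q in begin
    ‖ p ‖ℚ                                      ≤⟨ ‖‖ℚ-lower p i ⟩
    ℚ.∣ p ℚ.- fromℤ i ∣                         ≤⟨ ∣-∣-triangle p q (fromℤ i) ⟩
    ℚ.∣ p ℚ.- q ∣ ℚ.+ ℚ.∣ q ℚ.- fromℤ i ∣       ≡⟨ cong (ℚ.∣ p ℚ.- q ∣ ℚ.+_) e ⟨
    ℚ.∣ p ℚ.- q ∣ ℚ.+ ‖ q ‖ℚ                    ∎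

-- A relation rather than a function, because the order on ℝ is undecidable.
HasCardinality : {A : Set} → Pred A 0ℓ → ℕ → Set
HasCardinality {A} P c =
  ∃[ as ] Unique {A = A} as × (∀ a → a ∈ as ⇔ P a) × length as ≡ c

-- Sequences are indexed from 0: the term x n here is x_{n+1} in the usual
-- numbering, so that x_1, …, x_N is the restriction of x to Fin N.
ClosePair : (ℕ → ℝ) → (s : ℝ) (N : ℕ) .{{_ : NonZero N}} → Pred (Fin N × Fin N) 0ℓ
ClosePair x s N (l , m) =
  l ≢ m × ‖ x (toℕ l) - x (toℕ m) ‖ ≤ s * fromℚ (+ 1 ℚ./ N)

-- The count c is quantified universally.  A count cannot fail to exist (see
-- ¬¬-count), but constructively it need not be computable; asking for one
-- here would make the property stronger, hence its negation weaker.
PoissonianPairCorrelations : (ℕ → ℝ) → Set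
PoissonianPairCorrelations x =
  ∀ s → 0ℝ ≤ s → ∀ ε → 0ℝ < ε →
  ∃[ N₀ ] ∀ N .{{_ : NonZero N}} → N₀ ℕ.≤ N →
  ∀ c → HasCardinality (ClosePair x s N) c →
  ∣ fromℚ (+ c ℚ./ N) - fromℕ 2 * s ∣ ≤ ε

¬¬-count : ∀ {N} (P : Pred (Fin N × Fin N) 0ℓ) → ¬ ¬ (∃[ c ] HasCardinality P c)
¬¬-count {N} P k = allDec pairs λ ds →
  let P? = λ a → All.lookup ds (complete a)
      as = filter P? pairs
  in k (length as , as , Unique.filter⁺ P? unique ,
        (λ a → mk⇔ (λ a∈ → proj₂ (∈-filter⁻ P? {xs = pairs} a∈)) (∈-filter⁺ P? (complete a))) ,
        refl)
  where
  pairs : List (Fin N × Fin N)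
  pairs = cartesianProduct (allFin N) (allFin N)

  complete : ∀ a → a ∈ pairs
  complete (l , m) = ∈-cartesianProduct⁺ (∈-allFin l) (∈-allFin m)

  unique : Unique pairs
  unique = Unique.cartesianProduct⁺ (Unique.allFin⁺ N) (Unique.allFin⁺ N)

  allDec : ∀ as → ¬ ¬ All (λ a → Dec (P a)) as
  allDec []       k = k []
  allDec (a ∷ as) k = allDec as λ ds → k (no (λ p → k (yes p ∷ ds)) ∷ ds)

InUnitInterval : ℝ → Set
InUnitInterval x = 0ℝ ≤ x × x < 1ℝ

-- A subset of [0,1) of cardinality exactly m: point lists it in strictly
-- increasing order.
record PointSet (m : ℕ) : Set where
  field
    point      : Fin m → ℝ
    inUnit     : ∀ k → InUnitInterval (point k)
    increasing : ∀ k l → toℕ k ℕ.< toℕ l → point k < point l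

open PointSet public

-- Gaps are not taken cyclically: there are m ∸ 1 of them.
AtMostDistinctGaps : ℕ → ∀ {m} → PointSet m → Set
AtMostDistinctGaps s {m} A =
  Σ[ d ∈ (Fin s → ℝ) ] ∀ (k l : Fin m) → toℕ l ≡ suc (toℕ k) →
  ∃[ i ] point A l - point A k ≃ d i

-- J is the set of (0-based) indices j_1, …, j_M of the chosen terms, which
-- need not be distinct as points.
record FewGapSubset (x : ℕ → ℝ) (s : ℕ) (K γ : ℝ) (N : ℕ) : Set where
  field
    J         : Subset N
    J-large   : γ * fromℕ N ≤ fromℕ (card J)
    size      : ℕ
    size≤KN   : fromℕ size ≤ K * fromℕ N
    A         : PointSet size
    fewGaps   : AtMostDistinctGaps s A
    contained : ∀ j → j ∈ₛ J → ∃[ k ] x (toℕ j) ≃ point A k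

{-# OPTIONS --safe #-}
module Submission where

open import Defs
open import Data.Nat.Base using (ℕ) renaming (_≤_ to _≤ₙ_)
open import Data.Product.Base using (Σ-syntax; ∃-syntax; _×_)
open import Relation.Nullary using (¬_)

open import Data.Bool.Base using (true; false)
open import Data.Fin.Base as Fin using (Fin; toℕ)
import Data.Fin.Properties as Fin
open import Data.Fin.Subset using (Subset; inside; outside) renaming (_∈_ to _∈ₛ_; ∣_∣ to card)
open import Data.Fin.Subset.Properties using (_∈?_)
open import Data.Integer.Base as ℤ using (+_)
import Data.Integer.Properties as ℤ
open import Data.List.Base using (List; []; _∷_; length; filter; map; _++_; upTo)
import Data.List.Membership.DecPropositional as DecMembership
open import Data.List.Membership.Propositional using (_∈_)
open import Data.List.Membership.Propositional.Properties
  using (∈-filter⁻; ∈-++⁻; ∈-++⁺ˡ; ∈-++⁺ʳ; ∈-∃++; ∈-map⁻; ∈-upTo⁺)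
import Data.List.Properties as List
open import Data.List.Relation.Binary.Disjoint.Propositional using (Disjoint)
open import Data.List.Relation.Unary.All as All using ([]; _∷_)
import Data.List.Relation.Unary.All.Properties as All
open import Data.List.Relation.Unary.AllPairs using ([]; _∷_)
open import Data.List.Relation.Unary.Any using (here; there)
open import Data.List.Relation.Unary.Unique.Propositional using (Unique)
import Data.List.Relation.Unary.Unique.Propositional.Properties as Unique
open import Data.Nat.Base as ℕ using (zero; suc; NonZero)
open import Data.Nat.DivMod as ℕ using (_/_; _%_; _mod_)
import Data.Nat.Properties as ℕ
open import Data.Nat.Tactic.RingSolver using (solve-∀)
open import Data.Product.Base using (_,_; proj₁; proj₂)
open import Data.Rational.Base as ℚ using (ℚ; 0ℚ; 1ℚ; ½)
open import Data.Rational.Literals using (fromℤ)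
import Data.Rational.Properties as ℚ
open import Data.Rational.Solver using (module +-*-Solver)
import Data.Rational.Unnormalised.Base as ℚᵘ
import Data.Rational.Unnormalised.Properties as ℚᵘ
open import Data.Sum.Base using (_⊎_; inj₁; inj₂; [_,_]′)
open import Data.Vec.Base using ([]; _∷_; here; there)
open import Function.Base using (_∘_)
open import Function.Bundles using (Equivalence)
open import Relation.Binary.PropositionalEquality
  using (_≡_; _≢_; refl; sym; trans; cong; cong₂; subst; subst₂)
open import Relation.Nullary using (Dec; yes; no; contradiction)

open +-*-Solver using (solve; _:=_; _:+_; _:-_; _:*_; :-_; con)

-- If N terms have a positive proportion inside a set A with boundedly many gap
-- lengths, cut A into blocks of boundedly many consecutive points and [0,1) into
-- cells of length about 1/N.  By pigeonhole, some cN pairs of terms share both block and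
-- cell.  The difference of such a pair is determined by the word of gaps of its
-- block and the two offsets, so it takes boundedly many values, and c′N of the
-- pairs have exactly the same difference, of size O(1/N).  The pair correlation count then
-- jumps by c′N at a single radius, whereas its limit 2s is continuous.

-- Blocks and cells number about N each, so pigeonholing over all (block, cell) combinations would
-- be useless. Along the ordered set `A`, however, both indices are non-decreasing, so the
-- combinations that actually occur number at most the sum of the two ranges, and the lengths can be
-- chosen to make this sum about half the number of chosen terms. Blocks alone would not suffice,
-- since a block may contain long gaps; the cells keep the common difference at O(1/N). The value of
-- that difference is unknown and varies with N, while pair correlation gives a threshold only for a
-- fixed radius. Therefore a mesh of radii i/D is fixed in advance, with D and the number of radii
-- depending on s, K and γ alone, and the jump is located between two neighbouring mesh radii. Order
-- and integer part of a real are undecidable. Cells are cut from rational approximants at one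
-- common index, and the cases on distances and counts are made under double negation, which is
-- harmless because the goal is a negation.

private variable
  X : Set

-- Pigeonhole principles for finite lists

unique-⊆⇒length-≤ : {xs ys : List X} → Unique xs → (∀ {a} → a ∈ xs → a ∈ ys) →
                    length xs ℕ.≤ length ys
unique-⊆⇒length-≤ {xs = []} _ _ = ℕ.z≤n
unique-⊆⇒length-≤ {xs = x ∷ xs} (x∉xs ∷ u) xs⊆ys with ∈-∃++ (xs⊆ys (here refl))
... | as , bs , refl = begin
  suc (length xs)          ≤⟨ ℕ.s≤s (unique-⊆⇒length-≤ u drop) ⟩
  suc (length (as ++ bs))  ≡⟨ List.length-++-sucʳ as x bs ⟨
  length (as ++ x ∷ bs)    ∎
  where
  open ℕ.≤-Reasoning
  drop : ∀ {a} → a ∈ xs → a ∈ as ++ bs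
  drop a∈xs with ∈-++⁻ as (xs⊆ys (there a∈xs))
  ... | inj₁ a∈as         = ∈-++⁺ˡ a∈as
  ... | inj₂ (here refl)  = contradiction refl (All.lookup x∉xs a∈xs)
  ... | inj₂ (there a∈bs) = ∈-++⁺ʳ as a∈bs

-- Each element either becomes the representative of its value of `h` or is paired with that
-- representative. One pair per surplus element suffices for the linear count in `total`.
record Collisions (h : X → ℕ) (xs : List X) : Set where
  field
    pairs    : List (X × X)
    reps     : List X
    distinct : Unique pairs
    sound    : ∀ {a b} → (a , b) ∈ pairs → a ∈ xs × b ∈ xs × a ≢ b × h a ≡ h b
    reps⊆    : ∀ {a} → a ∈ reps → a ∈ xs
    separate : Unique (map h reps)
    total    : length xs ≡ length pairs ℕ.+ length reps

collisions : (h : X → ℕ) (xs : List X) → Unique xs → Collisions h xs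
collisions h [] [] = record
  { pairs = [] ; reps = [] ; distinct = [] ; sound = λ () ; reps⊆ = λ () ; separate = [] ; total = refl }
collisions {X} h (x ∷ xs) (x∉xs ∷ u) = add (DecMembership._∈?_ ℕ._≟_ (h x) (map h reps))
  where
  open Collisions (collisions h xs u)

  add : Dec (h x ∈ map h reps) → Collisions h (x ∷ xs)
  add (no hx∉) = record
    { pairs    = pairs
    ; reps     = x ∷ reps
    ; distinct = distinct
    ; sound    = λ ab∈ → let a∈ , b∈ , rest = sound ab∈ in there a∈ , there b∈ , rest
    ; reps⊆    = λ where
        (here refl) → here refl
        (there a∈)  → there (reps⊆ a∈)
    ; separate = All.¬Any⇒All¬ _ hx∉ ∷ separate
    ; total    = trans (cong suc total) (sym (ℕ.+-suc _ _))
    }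
  add (yes hx∈) with r , r∈ , hx≡hr ← ∈-map⁻ h hx∈ = record
    { pairs    = (x , r) ∷ pairs
    ; reps     = reps
    ; distinct = All.tabulate fresh ∷ distinct
    ; sound    = λ where
        (here refl) → here refl , there (reps⊆ r∈) , All.lookup x∉xs (reps⊆ r∈) , hx≡hr
        (there ab∈) → let a∈ , b∈ , rest = sound ab∈ in there a∈ , there b∈ , rest
    ; reps⊆    = λ a∈ → there (reps⊆ a∈)
    ; separate = separate
    ; total    = cong suc total
    }
    where
    fresh : ∀ {q} → q ∈ pairs → (x , r) ≢ q
    fresh q∈ refl = All.lookup x∉xs (proj₁ (sound q∈)) refl

pigeonhole-pairs : (h : X → ℕ) (H : ℕ) (xs : List X) → Unique xs → (∀ {a} → a ∈ xs → h a ℕ.< H) →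
  Σ[ ps ∈ List (X × X) ] Unique ps ×
    (∀ {a b} → (a , b) ∈ ps → a ∈ xs × b ∈ xs × a ≢ b × h a ≡ h b) ×
    length xs ℕ.≤ length ps ℕ.+ H
pigeonhole-pairs h H xs u h<H = pairs , distinct , sound , (begin
  length xs                      ≡⟨ total ⟩
  length pairs ℕ.+ length reps   ≤⟨ ℕ.+-monoʳ-≤ (length pairs) few ⟩
  length pairs ℕ.+ H             ∎)
  where
  open Collisions (collisions h xs u)
  open ℕ.≤-Reasoning
  few : length reps ℕ.≤ H
  few = begin
    length reps          ≡⟨ List.length-map h reps ⟨
    length (map h reps)  ≤⟨ unique-⊆⇒length-≤ separate (λ a∈ → let b , b∈ , e = ∈-map⁻ h a∈ in
                              subst (_∈ upTo H) (sym e) (∈-upTo⁺ (h<H (reps⊆ b∈)))) ⟩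
    length (upTo H)      ≡⟨ List.length-applyUpTo _ H ⟩
    H                    ∎

class : (X → ℕ) → ℕ → List X → List X
class f c = filter (λ a → f a ℕ.≟ c)

class-mono : (f : X → ℕ) (c : ℕ) (x : X) {xs ys : List X} →
  length (class f c ys) ℕ.≤ length (class f c xs) →
  length (class f c (x ∷ ys)) ℕ.≤ length (class f c (x ∷ xs))
class-mono f c x le with f x ℕ.≡ᵇ c
... | true  = ℕ.s≤s le
... | false = le

class-grow : (f : X → ℕ) (c : ℕ) (x : X) (xs : List X) →
  length (class f c xs) ℕ.≤ length (class f c (x ∷ xs))
class-grow f c x xs with f x ℕ.≡ᵇ c
... | true  = ℕ.n≤1+n _
... | false = ℕ.≤-refl

-- Splits off the class of the top value `w`. The remainder `ys` has no larger classes than `xs`, so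
-- a large class found in it is large in `xs` too.
length-class≤ : (f : X → ℕ) (w : ℕ) (xs : List X) → (∀ {a} → a ∈ xs → f a ℕ.< suc w) →
  ∃[ ys ] length xs ≡ length (class f w xs) ℕ.+ length ys ×
    (∀ {a} → a ∈ ys → f a ℕ.< w) × (∀ c → length (class f c ys) ℕ.≤ length (class f c xs))
length-class≤ f w [] _ = [] , refl , (λ ()) , λ _ → ℕ.z≤n
length-class≤ {X} f w (x ∷ xs) f< with length-class≤ f w xs (f< ∘ there)
... | ys , len , ys< , le = split (f x ℕ.≟ w)
  where
  split : Dec (f x ≡ w) →
    ∃[ zs ] length (x ∷ xs) ≡ length (class f w (x ∷ xs)) ℕ.+ length zs ×
      (∀ {a} → a ∈ zs → f a ℕ.< w) × (∀ c → length (class f c zs) ℕ.≤ length (class f c (x ∷ xs)))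
  split (yes fx≡w) = ys ,
    trans (cong suc len) (cong (λ zs → length zs ℕ.+ length ys)
      (sym (List.filter-accept (λ a → f a ℕ.≟ w) fx≡w))) ,
    ys< , λ c → ℕ.≤-trans (le c) (class-grow f c x xs)
  split (no fx≢w) = x ∷ ys ,
    trans (trans (cong suc len) (sym (ℕ.+-suc _ _))) (cong (λ zs → length zs ℕ.+ suc (length ys))
      (sym (List.filter-reject (λ a → f a ℕ.≟ w) fx≢w))) ,
    (λ where
      (here refl) → ℕ.≤∧≢⇒< (ℕ.≤-pred (f< (here refl))) fx≢w
      (there a∈)  → ys< a∈) ,
    λ c → class-mono f c x (le c)

largeClass : (f : X → ℕ) (w : ℕ) (xs : List X) → (∀ {a} → a ∈ xs → f a ℕ.< w) →
             ∃[ c ] length xs ℕ.≤ w ℕ.* length (class f c xs)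
largeClass f zero [] _ = 0 , ℕ.z≤n
largeClass f zero (x ∷ xs) f< = contradiction (f< (here refl)) λ ()
largeClass f (suc w) xs f< with length-class≤ f w xs f<
... | ys , len , ys< , le with largeClass f w ys ys<
... | c , many = choose (ℕ.≤-total (size w) (size c))
  where
  open ℕ.≤-Reasoning
  size : ℕ → ℕ
  size d = length (class f d xs)

  bound : ∀ {d} → size w ℕ.≤ size d → size c ℕ.≤ size d → length xs ℕ.≤ suc w ℕ.* size d
  bound {d} w≤d c≤d = begin
    length xs                                  ≡⟨ len ⟩
    size w ℕ.+ length ys                       ≤⟨ ℕ.+-mono-≤ w≤d many ⟩
    size d ℕ.+ w ℕ.* length (class f c ys)     ≤⟨ ℕ.+-monoʳ-≤ (size d) (ℕ.*-monoʳ-≤ w (ℕ.≤-trans (le c) c≤d)) ⟩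
    suc w ℕ.* size d                           ∎

  choose : size w ℕ.≤ size c ⊎ size c ℕ.≤ size w → ∃[ d ] length xs ℕ.≤ suc w ℕ.* size d
  choose (inj₁ w≤c) = c , bound w≤c ℕ.≤-refl
  choose (inj₂ c≤w) = w , bound ℕ.≤-refl c≤w

-- Finite subsets as lists, and two selection principles

elements : ∀ {n} → Subset n → List (Fin n)
elements []            = []
elements (inside ∷ p)  = Fin.zero ∷ map Fin.suc (elements p)
elements (outside ∷ p) = map Fin.suc (elements p)

length-elements : ∀ {n} (p : Subset n) → length (elements p) ≡ card p
length-elements []            = refl
length-elements (inside ∷ p)  = cong suc (trans (List.length-map Fin.suc (elements p)) (length-elements p))
length-elements (outside ∷ p) = trans (List.length-map Fin.suc (elements p)) (length-elements p)

∈-elements⁻ : ∀ {n} (p : Subset n) {i} → i ∈ elements p → i ∈ₛ p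
∈-elements⁻ (inside ∷ p) (here refl) = here
∈-elements⁻ (inside ∷ p) (there i∈) with _ , j∈ , refl ← ∈-map⁻ Fin.suc i∈ = there (∈-elements⁻ p j∈)
∈-elements⁻ (outside ∷ p) i∈ with _ , j∈ , refl ← ∈-map⁻ Fin.suc i∈ = there (∈-elements⁻ p j∈)

elements-unique : ∀ {n} (p : Subset n) → Unique (elements p)
elements-unique []            = []
elements-unique (inside ∷ p)  =
  All.tabulate (λ i∈ 0≡i → case (trans 0≡i (proj₂ (proj₂ (∈-map⁻ Fin.suc i∈))))) ∷
  Unique.map⁺ (λ { refl → refl }) (elements-unique p)
  where
  case : ∀ {n} {i : Fin n} → ¬ (Fin.zero ≡ Fin.suc i)
  case ()
elements-unique (outside ∷ p) = Unique.map⁺ (λ { refl → refl }) (elements-unique p)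

-- Meant for `P i` saying that a real is at most the i-th radius, which is undecidable; hence the
-- double negation. Descending from `T`: if `P` held one index lower, the induction hypothesis would
-- already give the conclusion, so `P` fails there and that index is the switch.
firstTrue : (P : ℕ → Set) (T : ℕ) → P T →
            ¬ ¬ (P 0 ⊎ ∃[ i ] i ℕ.< T × ¬ P i × P (suc i))
firstTrue P zero p k = k (inj₁ p)
firstTrue P (suc T) p k = k (inj₂ (T , ℕ.≤-refl , ¬PT , p))
  where
  ¬PT : ¬ P T
  ¬PT pT = firstTrue P T pT λ where
    (inj₁ p₀)            → k (inj₁ p₀)
    (inj₂ (i , i<T , q)) → k (inj₂ (i , ℕ.m≤n⇒m≤1+n i<T , q))

-- Lets a single sum of two monotone quantities encode both of them.
sameSummands : ∀ {a a′ b b′} → a ℕ.≤ a′ → b ℕ.≤ b′ → a ℕ.+ b ≡ a′ ℕ.+ b′ → a ≡ a′ × b ≡ b′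
sameSummands {a} {a′} {b} {b′} a≤ b≤ e = ea , ℕ.+-cancelˡ-≡ a b b′ (trans e (cong (ℕ._+ b′) (sym ea)))
  where
  ea : a ≡ a′
  ea = ℕ.≤-antisym a≤ (ℕ.≮⇒≥ λ a<a′ → ℕ.<⇒≢ (ℕ.+-mono-<-≤ a<a′ b≤) e)

-- Naturals among the rationals, and truncated floors

ι : ℕ → ℚ
ι n = fromℤ (+ n)

ι-+ : ∀ m n → ι (m ℕ.+ n) ≡ ι m ℚ.+ ι n
ι-+ m n = ℚ.toℚᵘ-injective (ℚᵘ.≃-trans (ℚᵘ.*≡* eq) (ℚᵘ.≃-sym (ℚ.toℚᵘ-homo-+ (ι m) (ι n))))
  where
  eq : + (m ℕ.+ n) ℤ.* + 1 ≡ (+ m ℤ.* + 1 ℤ.+ + n ℤ.* + 1) ℤ.* + 1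
  eq = cong (ℤ._* + 1) (sym (cong₂ ℤ._+_ (ℤ.*-identityʳ (+ m)) (ℤ.*-identityʳ (+ n))))

ι-* : ∀ m n → ι (m ℕ.* n) ≡ ι m ℚ.* ι n
ι-* m n = ℚ.toℚᵘ-injective (ℚᵘ.≃-trans (ℚᵘ.*≡* eq) (ℚᵘ.≃-sym (ℚ.toℚᵘ-homo-* (ι m) (ι n))))
  where
  eq : + (m ℕ.* n) ℤ.* + 1 ≡ (+ m ℤ.* + n) ℤ.* + 1
  eq = cong (ℤ._* + 1) (ℤ.pos-* m n)

ι-mono : ∀ {m n} → m ℕ.≤ n → ι m ℚ.≤ ι n
ι-mono m≤n = ℚ.*≤* (ℤ.*-monoʳ-≤-nonNeg (+ 1) (ℤ.+≤+ m≤n))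

ι-cancel : ∀ {m n} → ι m ℚ.≤ ι n → m ℕ.≤ n
ι-cancel (ℚ.*≤* h) = ℤ.drop‿+≤+ (subst₂ ℤ._≤_ (ℤ.*-identityʳ _) (ℤ.*-identityʳ _) h)

instance
  ι-nonNeg : ∀ {n} → ℚ.NonNegative (ι n)
  ι-nonNeg = _

ι-pos : ∀ n .{{_ : NonZero n}} → ℚ.Positive (ι n)
ι-pos (suc n) = _

/-* : ∀ a N .{{_ : NonZero N}} → (+ a ℚ./ N) ℚ.* ι N ≡ ι a
/-* a (suc n) = ℚ.toℚᵘ-injective
  (ℚᵘ.≃-trans (ℚ.toℚᵘ-homo-* (+ a ℚ./ suc n) (ι (suc n)))
  (ℚᵘ.≃-trans (ℚᵘ.*-congʳ {ℚ.toℚᵘ (ι (suc n))} (ℚ.toℚᵘ-fromℚᵘ (ℚᵘ.mkℚᵘ (+ a) n))) (ℚᵘ.*≡* eq)))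
  where
  eq : (+ a ℤ.* + suc n) ℤ.* + 1 ≡ + a ℤ.* + suc (n ℕ.* 1)
  eq = trans (ℤ.*-identityʳ _) (cong (λ k → + a ℤ.* + suc k) (sym (ℕ.*-identityʳ n)))

archimedean : ∀ q → ∃[ n ] q ℚ.≤ ι n
archimedean (ℚ.mkℚ (+ n) d-1 _) = n , ℚ.*≤* (ℤ.*-monoˡ-≤-nonNeg (+ n) (ℤ.+≤+ (ℕ.s≤s (ℕ.z≤n {d-1}))))
archimedean (ℚ.mkℚ ℤ.-[1+ n ] d-1 _) = 0 , ℚ.*≤* ℤ.-≤+

archimedean⁻¹ : ∀ ε → 0ℚ ℚ.< ε → ∃[ n ] 1ℚ ℚ.≤ ι n ℚ.* ε
archimedean⁻¹ ε 0<ε = let n , h = archimedean r in n , (begin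
    1ℚ          ≡⟨ ℚ.*-inverseˡ ε ⟨
    r ℚ.* ε     ≤⟨ ℚ.*-monoʳ-≤-nonNeg ε h ⟩
    ι n ℚ.* ε   ∎)
  where
  open ℚ.≤-Reasoning
  instance
    ε>0 : ℚ.Positive ε
    ε>0 = ℚ.positive 0<ε
    ε≥0 : ℚ.NonNegative ε
    ε≥0 = ℚ.pos⇒nonNeg ε
    ε≢0 : ℚ.NonZero ε
    ε≢0 = ℚ.pos⇒nonZero ε
  r : ℚ
  r = ℚ.1/ ε

-- To obtain p ≤ q from r ≤ s it suffices that the two differences agree, which is left to the ring solver.
≤-rearrange : ∀ {p q r s} → r ℚ.≤ s → q ℚ.- p ≡ s ℚ.- r → p ℚ.≤ q
≤-rearrange {p} {q} {r} {s} r≤s e = subst₂ ℚ._≤_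
  (ℚ.+-identityʳ p) (trans (cong (p ℚ.+_) (sym e)) (solve 2 (λ p q → p :+ (q :- p) := q) refl p q))
  (ℚ.+-monoʳ-≤ p (subst (ℚ._≤ s ℚ.- r) (ℚ.+-inverseʳ r) (ℚ.+-monoˡ-≤ (ℚ.- r) r≤s)))

p≤∣p∣ : ∀ p → p ℚ.≤ ℚ.∣ p ∣
p≤∣p∣ p with ℚ.≤-total 0ℚ p
... | inj₁ 0≤p = ℚ.≤-reflexive (sym (ℚ.0≤p⇒∣p∣≡p 0≤p))
... | inj₂ p≤0 = ℚ.≤-trans p≤0 (ℚ.0≤∣p∣ p)

-p≤∣p∣ : ∀ p → ℚ.- p ℚ.≤ ℚ.∣ p ∣
-p≤∣p∣ p = subst (ℚ.- p ℚ.≤_) (ℚ.∣-p∣≡∣p∣ p) (p≤∣p∣ (ℚ.- p))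

∣-∣≤ : ∀ {p q e} → p ℚ.≤ q ℚ.+ e → q ℚ.≤ p ℚ.+ e → ℚ.∣ p ℚ.- q ∣ ℚ.≤ e
∣-∣≤ {p} {q} {e} h₁ h₂ with ℚ.∣p∣≡p∨∣p∣≡-p (p ℚ.- q)
... | inj₁ eq = subst (ℚ._≤ e) (sym eq)
  (≤-rearrange h₁ (solve 3 (λ p q e → e :- (p :- q) := (q :+ e) :- p) refl p q e))
... | inj₂ eq = subst (ℚ._≤ e) (sym eq)
  (≤-rearrange h₂ (solve 3 (λ p q e → e :- (:- (p :- q)) := (p :+ e) :- q) refl p q e))

∣-∣-sym : ∀ p q → ℚ.∣ p ℚ.- q ∣ ≡ ℚ.∣ q ℚ.- p ∣
∣-∣-sym p q = trans (sym (ℚ.∣-p∣≡∣p∣ (p ℚ.- q)))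
  (cong ℚ.∣_∣ (solve 2 (λ p q → :- (p :- q) := q :- p) refl p q))

-- Junk value 0 for negative q.
boundedFloor : ℕ → ℚ → ℕ
boundedFloor zero    q = 0
boundedFloor (suc B) q with ι (suc B) ℚ.≤? q
... | yes _ = suc B
... | no _  = boundedFloor B q

boundedFloor≤bound : ∀ B q → boundedFloor B q ℕ.≤ B
boundedFloor≤bound zero    q = ℕ.z≤n
boundedFloor≤bound (suc B) q with ι (suc B) ℚ.≤? q
... | yes _ = ℕ.≤-refl
... | no _  = ℕ.m≤n⇒m≤1+n (boundedFloor≤bound B q)

boundedFloor-mono : ∀ B {q r} → q ℚ.≤ r → boundedFloor B q ℕ.≤ boundedFloor B r
boundedFloor-mono zero    q≤r = ℕ.z≤n
boundedFloor-mono (suc B) {q} {r} q≤r with ι (suc B) ℚ.≤? q | ι (suc B) ℚ.≤? r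
... | yes _  | yes _  = ℕ.≤-refl
... | yes b≤q | no b≰r = contradiction (ℚ.≤-trans b≤q q≤r) b≰r
... | no _   | yes _  = ℕ.m≤n⇒m≤1+n (boundedFloor≤bound B q)
... | no _   | no _   = boundedFloor-mono B q≤r

boundedFloor≤ : ∀ B {q} → 0ℚ ℚ.≤ q → ι (boundedFloor B q) ℚ.≤ q
boundedFloor≤ zero    0≤q = 0≤q
boundedFloor≤ (suc B) {q} 0≤q with ι (suc B) ℚ.≤? q
... | yes b≤q = b≤q
... | no _    = boundedFloor≤ B 0≤q

≤boundedFloor+1 : ∀ B {q} → q ℚ.≤ ι (suc B) → q ℚ.≤ ι (suc (boundedFloor B q))
≤boundedFloor+1 zero    q≤ = q≤
≤boundedFloor+1 (suc B) {q} q≤ with ι (suc B) ℚ.≤? q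
... | yes _  = q≤
... | no b≰q = ≤boundedFloor+1 B (ℚ.<⇒≤ (ℚ.≰⇒> b≰q))

-- Eventual properties and null sequences

Eventually : (ℕ → Set) → Set
Eventually P = ∃[ N ] ∀ n → N ℕ.≤ n → P n

eventually-map : {P Q : ℕ → Set} → (∀ n → P n → Q n) → Eventually P → Eventually Q
eventually-map f (N , h) = N , λ n N≤n → f n (h n N≤n)

eventually-× : {P Q : ℕ → Set} → Eventually P → Eventually Q → Eventually (λ n → P n × Q n)
eventually-× (M , h) (N , k) = M ℕ.⊔ N , λ n le →
  h n (ℕ.m⊔n≤o⇒m≤o M N le) , k n (ℕ.m⊔n≤o⇒n≤o M N le)

eventually-∀< : (P : ℕ → ℕ → Set) (T : ℕ) → (∀ i → i ℕ.< T → Eventually (P i)) →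
                Eventually (λ n → ∀ i → i ℕ.< T → P i n)
eventually-∀< P zero    h = 0 , λ _ _ _ ()
eventually-∀< P (suc T) h =
  eventually-map glue (eventually-× (h T ℕ.≤-refl) (eventually-∀< P T (λ i i<T → h i (ℕ.m≤n⇒m≤1+n i<T))))
  where
  glue : ∀ n → P T n × (∀ i → i ℕ.< T → P i n) → ∀ i → i ℕ.< suc T → P i n
  glue n (pT , p) i i<1+T with ℕ.m≤n⇒m<n∨m≡n (ℕ.≤-pred i<1+T)
  ... | inj₁ i<T  = p i i<T
  ... | inj₂ refl = pT

-- `x ≃ y` unfolds to `Null` of the termwise difference, so a chain of real equalities becomes a sum
-- of null sequences and one ring identity passed to `null-ext`.
Null : (ℕ → ℚ) → Set
Null u = ∀ ε → 0ℚ ℚ.< ε → Eventually (λ n → ℚ.∣ u n ∣ ℚ.≤ ε)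

½*-pos : ∀ {ε} → 0ℚ ℚ.< ε → 0ℚ ℚ.< ½ ℚ.* ε
½*-pos {ε} 0<ε = subst (ℚ._< ½ ℚ.* ε) (ℚ.*-zeroʳ ½) (ℚ.*-monoʳ-<-pos ½ 0<ε)

½+½ : ∀ ε → ½ ℚ.* ε ℚ.+ ½ ℚ.* ε ≡ ε
½+½ ε = trans (sym (ℚ.*-distribʳ-+ ε ½ ½)) (ℚ.*-identityˡ ε)

null-ext : {u v : ℕ → ℚ} → (∀ n → u n ≡ v n) → Null u → Null v
null-ext e h ε 0<ε = eventually-map (λ n → subst (λ t → ℚ.∣ t ∣ ℚ.≤ ε) (e n)) (h ε 0<ε)

null-0 : {u : ℕ → ℚ} → (∀ n → u n ≡ 0ℚ) → Null u
null-0 e ε 0<ε = 0 , λ n _ → subst (λ t → ℚ.∣ t ∣ ℚ.≤ ε) (sym (e n)) (ℚ.<⇒≤ 0<ε)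

null-- : {u v : ℕ → ℚ} → Null u → Null v → Null (λ n → u n ℚ.- v n)
null-- {u} {v} hu hv ε 0<ε =
  eventually-map bound (eventually-× (hu (½ ℚ.* ε) (½*-pos 0<ε)) (hv (½ ℚ.* ε) (½*-pos 0<ε)))
  where
  open ℚ.≤-Reasoning
  bound : ∀ n → ℚ.∣ u n ∣ ℚ.≤ ½ ℚ.* ε × ℚ.∣ v n ∣ ℚ.≤ ½ ℚ.* ε → ℚ.∣ u n ℚ.- v n ∣ ℚ.≤ ε
  bound n (bu , bv) = begin
    ℚ.∣ u n ℚ.- v n ∣           ≤⟨ ℚ.∣p-q∣≤∣p∣+∣q∣ (u n) (v n) ⟩
    ℚ.∣ u n ∣ ℚ.+ ℚ.∣ v n ∣     ≤⟨ ℚ.+-mono-≤ bu bv ⟩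
    ½ ℚ.* ε ℚ.+ ½ ℚ.* ε         ≡⟨ ½+½ ε ⟩
    ε                           ∎

null-+ : {u v : ℕ → ℚ} → Null u → Null v → Null (λ n → u n ℚ.+ v n)
null-+ {u} {v} hu hv = null-ext
  (λ n → solve 2 (λ u v → u :- ((v :- v) :- v) := u :+ v) refl (u n) (v n))
  (null-- hu (null-- (null-- hv hv) hv))

-- Distance to the nearest integer and order on the reals

‖‖ℚ-lip : ∀ p q → ‖ p ‖ℚ ℚ.≤ ‖ q ‖ℚ ℚ.+ ℚ.∣ q ℚ.- p ∣
‖‖ℚ-lip p q = let i , e = ‖‖ℚ-attained q in begin
  ‖ p ‖ℚ                                        ≤⟨ ‖‖ℚ-lower p i ⟩
  ℚ.∣ p ℚ.- fromℤ i ∣                           ≡⟨ cong ℚ.∣_∣ (solve 3 (λ p q i → p :- i := (q :- i) :- (q :- p)) refl p q (fromℤ i)) ⟩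
  ℚ.∣ (q ℚ.- fromℤ i) ℚ.- (q ℚ.- p) ∣           ≤⟨ ℚ.∣p-q∣≤∣p∣+∣q∣ (q ℚ.- fromℤ i) (q ℚ.- p) ⟩
  ℚ.∣ q ℚ.- fromℤ i ∣ ℚ.+ ℚ.∣ q ℚ.- p ∣         ≡⟨ cong (ℚ._+ ℚ.∣ q ℚ.- p ∣) e ⟨
  ‖ q ‖ℚ ℚ.+ ℚ.∣ q ℚ.- p ∣                      ∎
  where open ℚ.≤-Reasoning

‖‖ℚ≤∣∣ : ∀ p → ‖ p ‖ℚ ℚ.≤ ℚ.∣ p ∣
‖‖ℚ≤∣∣ p = subst (λ t → ‖ p ‖ℚ ℚ.≤ ℚ.∣ t ∣) (ℚ.+-identityʳ p) (‖‖ℚ-lower p (+ 0))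

‖‖≤-resp-≃ : ∀ {z z′} t → z ≃ z′ → ‖ z ‖ ≤ t → ‖ z′ ‖ ≤ t
‖‖≤-resp-≃ {z} {z′} t z≃z′ z≤t ε 0<ε =
  eventually-map bound (eventually-× (z≃z′ (½ ℚ.* ε) (½*-pos 0<ε)) (z≤t (½ ℚ.* ε) (½*-pos 0<ε)))
  where
  open ℚ.≤-Reasoning
  bound : ∀ n → ℚ.∣ seq z n ℚ.- seq z′ n ∣ ℚ.≤ ½ ℚ.* ε × ‖ seq z n ‖ℚ ℚ.≤ seq t n ℚ.+ ½ ℚ.* ε →
          ‖ seq z′ n ‖ℚ ℚ.≤ seq t n ℚ.+ ε
  bound n (near , le) = begin
    ‖ seq z′ n ‖ℚ                                          ≤⟨ ‖‖ℚ-lip (seq z′ n) (seq z n) ⟩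
    ‖ seq z n ‖ℚ ℚ.+ ℚ.∣ seq z n ℚ.- seq z′ n ∣            ≤⟨ ℚ.+-mono-≤ le near ⟩
    (seq t n ℚ.+ ½ ℚ.* ε) ℚ.+ ½ ℚ.* ε                      ≡⟨ ℚ.+-assoc (seq t n) _ _ ⟩
    seq t n ℚ.+ (½ ℚ.* ε ℚ.+ ½ ℚ.* ε)                      ≡⟨ cong (seq t n ℚ.+_) (½+½ ε) ⟩
    seq t n ℚ.+ ε                                          ∎

‖‖≤-of-≃ : ∀ {z w b t} → z ≃ w → Eventually (λ n → ℚ.∣ seq w n ∣ ℚ.≤ b) → b ℚ.≤ t → ‖ z ‖ ≤ fromℚ t
‖‖≤-of-≃ {z} {w} {b} {t} z≃w small b≤t ε 0<ε =
  eventually-map bound (eventually-× (z≃w ε 0<ε) small)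
  where
  open ℚ.≤-Reasoning
  bound : ∀ n → ℚ.∣ seq z n ℚ.- seq w n ∣ ℚ.≤ ε × ℚ.∣ seq w n ∣ ℚ.≤ b → ‖ seq z n ‖ℚ ℚ.≤ t ℚ.+ ε
  bound n (near , le) = begin
    ‖ seq z n ‖ℚ                                        ≤⟨ ‖‖ℚ-lip (seq z n) (seq w n) ⟩
    ‖ seq w n ‖ℚ ℚ.+ ℚ.∣ seq w n ℚ.- seq z n ∣          ≤⟨ ℚ.+-mono-≤ (‖‖ℚ≤∣∣ (seq w n))
                                                             (ℚ.≤-reflexive (∣-∣-sym (seq w n) (seq z n))) ⟩
    ℚ.∣ seq w n ∣ ℚ.+ ℚ.∣ seq z n ℚ.- seq w n ∣         ≤⟨ ℚ.+-mono-≤ (ℚ.≤-trans le b≤t) near ⟩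
    t ℚ.+ ε                                             ∎

fromℚ-mono : ∀ {p q} → p ℚ.≤ q → fromℚ p ≤ fromℚ q
fromℚ-mono {p} {q} p≤q ε 0<ε = 0 , λ _ _ →
  subst (ℚ._≤ q ℚ.+ ε) (ℚ.+-identityʳ p) (ℚ.+-mono-≤ p≤q (ℚ.<⇒≤ 0<ε))

≤-mono-fromℚ : ∀ {x p q} → x ≤ fromℚ p → p ℚ.≤ q → x ≤ fromℚ q
≤-mono-fromℚ {x} x≤p p≤q ε 0<ε =
  eventually-map (λ n le → ℚ.≤-trans le (ℚ.+-monoˡ-≤ ε p≤q)) (x≤p ε 0<ε)

0<1ℚ : 0ℚ ℚ.< 1ℚ
0<1ℚ = ℚ.positive⁻¹ 1ℚ

-- Integer bounds extracted from real inequalities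

-- Some rational ε > 0 lies eventually below γ, and pε ≥ 1 gives N ≤ pεN ≤ p(c + 1). The unit added
-- to `c` is the slack of `_≤_`, taken as 1; `suc p` makes the factor usable as a divisor.
positive⇒linearBound : ∀ {γ} → 0ℝ < γ →
  ∃[ p ] ∀ N c → γ * fromℕ N ≤ fromℕ c → N ℕ.≤ suc p ℕ.* suc c
positive⇒linearBound {γ} (ε , 0<ε , n₀ , ε≤γ) = let p , 1≤pε = archimedean⁻¹ ε 0<ε in
  p , λ N c γN≤c →
  let n₁ , h = γN≤c 1ℚ 0<1ℚ
      n = n₀ ℕ.⊔ n₁
  in ℕ.≤-trans (ι-cancel (begin
    ι N                                ≡⟨ ℚ.*-identityˡ (ι N) ⟨
    1ℚ ℚ.* ι N                         ≤⟨ ℚ.*-monoʳ-≤-nonNeg (ι N) 1≤pε ⟩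
    (ι p ℚ.* ε) ℚ.* ι N                ≡⟨ ℚ.*-assoc (ι p) ε (ι N) ⟩
    ι p ℚ.* (ε ℚ.* ι N)                ≡⟨ cong (λ e → ι p ℚ.* (e ℚ.* ι N)) (ℚ.+-identityˡ ε) ⟨
    ι p ℚ.* ((0ℚ ℚ.+ ε) ℚ.* ι N)       ≤⟨ ℚ.*-monoˡ-≤-nonNeg (ι p) (ℚ.*-monoʳ-≤-nonNeg (ι N) (ε≤γ n (ℕ.m≤m⊔n n₀ n₁))) ⟩
    ι p ℚ.* (seq γ n ℚ.* ι N)          ≤⟨ ℚ.*-monoˡ-≤-nonNeg (ι p) (h n (ℕ.m≤n⊔m n₀ n₁)) ⟩
    ι p ℚ.* (ι c ℚ.+ ι 1)              ≡⟨ cong (ι p ℚ.*_) (ι-+ c 1) ⟨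
    ι p ℚ.* ι (c ℕ.+ 1)                ≡⟨ ι-* p (c ℕ.+ 1) ⟨
    ι (p ℕ.* (c ℕ.+ 1))                ≡⟨ cong (λ d → ι (p ℕ.* d)) (ℕ.+-comm c 1) ⟩
    ι (p ℕ.* suc c)                    ∎)) (ℕ.m≤n+m (p ℕ.* suc c) (suc c))
  where open ℚ.≤-Reasoning

-- Slack 1 in the order gives m ≤ kN + 1, and N ≥ 1 absorbs the unit into one more multiple of `N`.
realMultiple⇒linearBound : ∀ K → ∃[ k ] ∀ N .{{_ : NonZero N}} m → fromℕ m ≤ K * fromℕ N → m ℕ.≤ suc k ℕ.* N
realMultiple⇒linearBound K =
  let n₀ , close = cauchy K 1ℚ 0<1ℚ
      k , K≤k = archimedean (seq K n₀ ℚ.+ 1ℚ)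
  in k , λ N m m≤KN →
  let n₁ , h = m≤KN 1ℚ 0<1ℚ
      n = n₀ ℕ.⊔ n₁
      Kₙ≤k : seq K n ℚ.≤ ι k
      Kₙ≤k = ℚ.≤-trans (≤-rearrange (ℚ.≤-trans (p≤∣p∣ _) (close n n₀ (ℕ.m≤m⊔n n₀ n₁) ℕ.≤-refl))
               (solve 3 (λ a b e → (b :+ e) :- a := e :- (a :- b)) refl (seq K n) (seq K n₀) 1ℚ)) K≤k
  in ℕ.≤-trans (ι-cancel (begin
    ι m                                ≤⟨ h n (ℕ.m≤n⊔m n₀ n₁) ⟩
    seq K n ℚ.* ι N ℚ.+ ι 1            ≤⟨ ℚ.+-monoˡ-≤ (ι 1) (ℚ.*-monoʳ-≤-nonNeg (ι N) Kₙ≤k) ⟩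
    ι k ℚ.* ι N ℚ.+ ι 1                ≡⟨ cong (ℚ._+ ι 1) (ι-* k N) ⟨
    ι (k ℕ.* N) ℚ.+ ι 1                ≡⟨ ι-+ (k ℕ.* N) 1 ⟨
    ι (k ℕ.* N ℕ.+ 1)                  ∎))
    (subst (k ℕ.* N ℕ.+ 1 ℕ.≤_) (ℕ.+-comm (k ℕ.* N) N) (ℕ.+-monoʳ-≤ (k ℕ.* N) (ℕ.>-nonZero⁻¹ N)))
  where open ℚ.≤-Reasoning

-- Pair correlation counts on a mesh of radii

multiple : (D : ℕ) .{{_ : NonZero D}} → ℕ → ℝ
multiple D i = fromℚ (ι i ℚ.* (+ 1 ℚ./ D))

1/-pos : ∀ D .{{_ : NonZero D}} → 0ℚ ℚ.< + 1 ℚ./ D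
1/-pos D = ℚ.*-cancelʳ-<-nonNeg (ι D) (subst₂ ℚ._<_
  (sym (ℚ.*-zeroˡ (ι D))) (sym (/-* 1 D)) 0<1ℚ)

-- The estimate |c/N - 2i/D| ≤ 2/D with denominators cleared. `NonZero N` is a premise inside, so
-- that this is a predicate on all of ℕ to which `Eventually` applies.
CountBounds : (ℕ → ℝ) → (D : ℕ) .{{_ : NonZero D}} → ℕ → ℕ → Set
CountBounds x D i N = .{{_ : NonZero N}} → ∀ c → HasCardinality (ClosePair x (multiple D i) N) c →
  c ℕ.* D ℕ.≤ (2 ℕ.* i ℕ.+ 2) ℕ.* N × 2 ℕ.* i ℕ.* N ℕ.≤ c ℕ.* D ℕ.+ 2 ℕ.* N

poissonian⇒countBounds : ∀ {x} → PoissonianPairCorrelations x →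
  ∀ D .{{_ : NonZero D}} i → Eventually (CountBounds x D i)
poissonian⇒countBounds {x} ppc D i =
  let N₀ , h = ppc (multiple D i) (fromℚ-mono 0≤iδ) (fromℚ δ)
                 (δ , 1/-pos D , 0 , λ _ _ → ℚ.≤-reflexive (ℚ.+-identityˡ δ))
  in N₀ , λ N N₀≤N c hasCard → bounds N c (h N N₀≤N c hasCard)
  where
  open ℚ.≤-Reasoning

  δ : ℚ
  δ = + 1 ℚ./ D

  0≤iδ : 0ℚ ℚ.≤ ι i ℚ.* δ
  0≤iδ = subst (ℚ._≤ ι i ℚ.* δ) (ℚ.*-zeroʳ (ι i)) (ℚ.*-monoˡ-≤-nonNeg (ι i) (ℚ.<⇒≤ (1/-pos D)))

  bounds : ∀ N .{{_ : NonZero N}} c →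
    ∣ fromℚ (+ c ℚ./ N) - fromℕ 2 * multiple D i ∣ ≤ fromℚ δ →
    c ℕ.* D ℕ.≤ (2 ℕ.* i ℕ.+ 2) ℕ.* N × 2 ℕ.* i ℕ.* N ℕ.≤ c ℕ.* D ℕ.+ 2 ℕ.* N
  bounds N c le = ι-cancel upper , ι-cancel lower
    where
    y : ℚ
    y = + c ℚ./ N

    -- One `δ` is the tolerance requested from pair correlation, the other the slack of `_≤_` on
    -- reals.
    near : ℚ.∣ y ℚ.- ι 2 ℚ.* (ι i ℚ.* δ) ∣ ℚ.≤ δ ℚ.+ δ
    near = let n , h = le δ (1/-pos D) in h n ℕ.≤-refl

    scale : ∀ u v → u ℚ.≤ v → u ℚ.* ι D ℚ.* ι N ℚ.≤ v ℚ.* ι D ℚ.* ι N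
    scale _ _ u≤v = ℚ.*-monoʳ-≤-nonNeg (ι N) (ℚ.*-monoʳ-≤-nonNeg (ι D) u≤v)

    cD : ι (c ℕ.* D) ≡ y ℚ.* ι D ℚ.* ι N
    cD = trans (ι-* c D) (trans (cong (ℚ._* ι D) (sym (/-* c N)))
      (solve 3 (λ y N D → y :* N :* D := y :* D :* N) refl y (ι N) (ι D)))

    eδ : ∀ e → ι e ℚ.* δ ℚ.* ι D ℚ.* ι N ≡ ι (e ℕ.* N)
    eδ e = trans (cong (ℚ._* ι N) (trans (ℚ.*-assoc (ι e) δ (ι D))
      (trans (cong (ι e ℚ.*_) (/-* 1 D)) (ℚ.*-identityʳ (ι e))))) (sym (ι-* e N))

    upper : ι (c ℕ.* D) ℚ.≤ ι ((2 ℕ.* i ℕ.+ 2) ℕ.* N)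
    upper = begin
      ι (c ℕ.* D)                                     ≡⟨ cD ⟩
      y ℚ.* ι D ℚ.* ι N                               ≤⟨ scale y ((ι 2 ℚ.* ι i ℚ.+ ι 2) ℚ.* δ) (≤-rearrange (ℚ.≤-trans (p≤∣p∣ _) near)
        (solve 3 (λ y i δ → (con (ι 2) :* i :+ con (ι 2)) :* δ :- y :=
                            (δ :+ δ) :- (y :- con (ι 2) :* (i :* δ))) refl y (ι i) δ)) ⟩
      (ι 2 ℚ.* ι i ℚ.+ ι 2) ℚ.* δ ℚ.* ι D ℚ.* ι N     ≡⟨ cong (λ e → (e ℚ.+ ι 2) ℚ.* δ ℚ.* ι D ℚ.* ι N) (ι-* 2 i) ⟨
      (ι (2 ℕ.* i) ℚ.+ ι 2) ℚ.* δ ℚ.* ι D ℚ.* ι N     ≡⟨ cong (λ e → e ℚ.* δ ℚ.* ι D ℚ.* ι N) (ι-+ (2 ℕ.* i) 2) ⟨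
      ι (2 ℕ.* i ℕ.+ 2) ℚ.* δ ℚ.* ι D ℚ.* ι N         ≡⟨ eδ (2 ℕ.* i ℕ.+ 2) ⟩
      ι ((2 ℕ.* i ℕ.+ 2) ℕ.* N)                       ∎

    lower : ι (2 ℕ.* i ℕ.* N) ℚ.≤ ι (c ℕ.* D ℕ.+ 2 ℕ.* N)
    lower = begin
      ι (2 ℕ.* i ℕ.* N)                               ≡⟨ eδ (2 ℕ.* i) ⟨
      ι (2 ℕ.* i) ℚ.* δ ℚ.* ι D ℚ.* ι N               ≤⟨ scale (ι (2 ℕ.* i) ℚ.* δ) (y ℚ.+ ι 2 ℚ.* δ) (≤-rearrange (ℚ.≤-trans (-p≤∣p∣ _) near)
        (trans (cong (λ e → (y ℚ.+ ι 2 ℚ.* δ) ℚ.- e ℚ.* δ) (ι-* 2 i))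
        (solve 3 (λ y i δ → (y :+ con (ι 2) :* δ) :- (con (ι 2) :* i) :* δ :=
                            (δ :+ δ) :- (:- (y :- con (ι 2) :* (i :* δ)))) refl y (ι i) δ))) ⟩
      (y ℚ.+ ι 2 ℚ.* δ) ℚ.* ι D ℚ.* ι N               ≡⟨ solve 4 (λ y δ D N →
        (y :+ con (ι 2) :* δ) :* D :* N := y :* D :* N :+ con (ι 2) :* δ :* D :* N) refl y δ (ι D) (ι N) ⟩
      y ℚ.* ι D ℚ.* ι N ℚ.+ ι 2 ℚ.* δ ℚ.* ι D ℚ.* ι N ≡⟨ cong₂ ℚ._+_ (sym cD) (eδ 2) ⟩
      ι (c ℕ.* D) ℚ.+ ι (2 ℕ.* N)                     ≡⟨ ι-+ (c ℕ.* D) (2 ℕ.* N) ⟨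
      ι (c ℕ.* D ℕ.+ 2 ℕ.* N)                         ∎

-- Words of gaps and translated blocks

difference : (ℕ → ℝ) → ∀ {N} → Fin N × Fin N → ℝ
difference x (l , m) = x (toℕ l) - x (toℕ m)

-- The value 0ℝ outside the index range is never used.
extend : ∀ {m} → (Fin m → ℝ) → ℕ → ℝ
extend {m} f i with i ℕ.<? m
... | yes i<m = f (Fin.fromℕ< i<m)
... | no _    = 0ℝ

extend-< : ∀ {m} (f : Fin m → ℝ) {i} (i<m : i ℕ.< m) → extend f i ≡ f (Fin.fromℕ< i<m)
extend-< {m} f {i} i<m with i ℕ.<? m
... | yes _  = refl
... | no i≮m = contradiction i<m i≮m

extend-toℕ : ∀ {m} (f : Fin m → ℝ) k → extend f (toℕ k) ≡ f k
extend-toℕ f k = trans (extend-< f (Fin.toℕ<n k)) (cong f (Fin.fromℕ<-toℕ k (Fin.toℕ<n k)))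

-- Blocks with the same word of gaps are translates of each other.
translate : (a : ℕ → ℝ) (m L : ℕ) (g : ℕ → ℕ) →
  (∀ κ κ′ → suc κ ℕ.< m → suc κ′ ℕ.< m → g κ ≡ g κ′ → a (suc κ) - a κ ≃ a (suc κ′) - a κ′) →
  ∀ β β′ → (∀ i → i ℕ.< L → g (i ℕ.+ β) ≡ g (i ℕ.+ β′)) →
  ∀ i → i ℕ.< L → i ℕ.+ β ℕ.< m → i ℕ.+ β′ ℕ.< m →
  a (i ℕ.+ β) - a (i ℕ.+ β′) ≃ a β - a β′
translate a m L g gaps β β′ same zero _ _ _ = null-0 (λ n → ℚ.+-inverseʳ (seq (a β - a β′) n))
translate a m L g gaps β β′ same (suc i) 1+i<L b<m b′<m = null-ext
  (λ n → solve 6 (λ p q p₀ q₀ u v →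
      ((p :- p₀) :- (q :- q₀)) :+ ((p₀ :- q₀) :- (u :- v)) := (p :- q) :- (u :- v)) refl
    (seq (a (suc (i ℕ.+ β))) n) (seq (a (suc (i ℕ.+ β′))) n)
    (seq (a (i ℕ.+ β)) n) (seq (a (i ℕ.+ β′)) n) (seq (a β) n) (seq (a β′) n))
  (null-+ (gaps (i ℕ.+ β) (i ℕ.+ β′) b<m b′<m (same i i<L))
          (translate a m L g gaps β β′ same i i<L (ℕ.<⇒≤ b<m) (ℕ.<⇒≤ b′<m)))
  where
  i<L : i ℕ.< L
  i<L = ℕ.<⇒≤ 1+i<L

-- The extra letter `Fin.zero` marks positions followed by no gap, so that words of full length
-- exist even for a block cut off by the end of `A`.
gapIndex : ∀ {s m} (A : PointSet m) → AtMostDistinctGaps s A → ℕ → Fin (suc s)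
gapIndex {m = m} A (d , gaps) κ with suc κ ℕ.<? m
... | yes 1+κ<m = Fin.suc (proj₁ (gaps (Fin.fromℕ< (ℕ.<⇒≤ 1+κ<m)) (Fin.fromℕ< 1+κ<m)
        (trans (Fin.toℕ-fromℕ< 1+κ<m) (cong suc (sym (Fin.toℕ-fromℕ< (ℕ.<⇒≤ 1+κ<m)))))))
... | no _      = Fin.zero

gapIndex-< : ∀ {s m} (A : PointSet m) (G : AtMostDistinctGaps s A) κ (1+κ<m : suc κ ℕ.< m) →
  ∃[ i ] gapIndex A G κ ≡ Fin.suc i ×
    point A (Fin.fromℕ< 1+κ<m) - point A (Fin.fromℕ< (ℕ.<⇒≤ 1+κ<m)) ≃ proj₁ G i
gapIndex-< {m = m} A (d , gaps) κ 1+κ<m with suc κ ℕ.<? m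
... | yes lt   = _ , refl , proj₂ (gaps _ _ _)
... | no 1+κ≮m = contradiction 1+κ<m 1+κ≮m

gap≃ : ∀ {s m} (A : PointSet m) (G : AtMostDistinctGaps s A) κ → suc κ ℕ.< m →
  ∃[ i ] gapIndex A G κ ≡ Fin.suc i × extend (point A) (suc κ) - extend (point A) κ ≃ proj₁ G i
gap≃ A G κ lt = let i , e , h = gapIndex-< A G κ lt in
  i , e , subst₂ (λ u v → u - v ≃ proj₁ G i)
    (sym (extend-< (point A) lt)) (sym (extend-< (point A) (ℕ.<⇒≤ lt))) h

sameGapIndex⇒≃ : ∀ {s m} (A : PointSet m) (G : AtMostDistinctGaps s A) (let a = extend (point A)) →
  ∀ κ κ′ → suc κ ℕ.< m → suc κ′ ℕ.< m → toℕ (gapIndex A G κ) ≡ toℕ (gapIndex A G κ′) →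
  a (suc κ) - a κ ≃ a (suc κ′) - a κ′
sameGapIndex⇒≃ A G κ κ′ lt lt′ e with gap≃ A G κ lt | gap≃ A G κ′ lt′
... | i , gi , h | i′ , gi′ , h′ with trans (sym gi) (trans (Fin.toℕ-injective e) gi′)
... | refl = null-ext
  (λ n → solve 5 (λ p q p′ q′ d → ((p :- q) :- d) :- ((p′ :- q′) :- d) := (p :- q) :- (p′ :- q′)) refl
    (seq (a (suc κ)) n) (seq (a κ) n) (seq (a (suc κ′)) n) (seq (a κ′) n) (seq (proj₁ G i) n))
  (null-- h h′)
  where
  a : ℕ → ℝ
  a = extend (point A)

-- Simultaneous rational approximation of the point set

-- At such an index the approximants can stand in for the points. `lower` allows values down to -1
-- because `0ℝ ≤ a κ` controls approximants only up to a positive slack, taken as 1.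
record GoodIndex (a : ℕ → ℝ) (m : ℕ) (ν : ℚ) (n : ℕ) : Set where
  field
    monotone : ∀ κ → κ ℕ.< m → ∀ κ′ → κ′ ℕ.< m → κ ℕ.≤ κ′ → seq (a κ) n ℚ.≤ seq (a κ′) n
    lower    : ∀ κ → κ ℕ.< m → 0ℚ ℚ.≤ seq (a κ) n ℚ.+ 1ℚ
    upper    : ∀ κ → κ ℕ.< m → seq (a κ) n ℚ.≤ 1ℚ
    settled  : ∀ κ → κ ℕ.< m → ∀ n′ → n ℕ.≤ n′ → ℚ.∣ seq (a κ) n′ ℚ.- seq (a κ) n ∣ ℚ.≤ ν

<⇒eventually≤ : ∀ {x y} → x < y → Eventually (λ n → seq x n ℚ.≤ seq y n)
<⇒eventually≤ {x} (ε , 0<ε , N , h) = N , λ n N≤n → ℚ.≤-trans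
  (subst (ℚ._≤ seq x n ℚ.+ ε) (ℚ.+-identityʳ (seq x n)) (ℚ.+-monoʳ-≤ (seq x n) (ℚ.<⇒≤ 0<ε))) (h n N≤n)

goodIndex : ∀ {m} (A : PointSet m) ν → 0ℚ ℚ.< ν → ∃[ n ] GoodIndex (extend (point A)) m ν n
goodIndex {m} A ν 0<ν =
  let N₁ , h₁ = eventually-∀< _ m λ κ κ<m → eventually-∀< _ m λ κ′ κ′<m → ordered κ κ<m κ′ κ′<m
      N₂ , h₂ = eventually-∀< (λ κ n → 0ℚ ℚ.≤ seq (a κ) n ℚ.+ 1ℚ) m λ κ κ<m → proj₁ (unit κ κ<m) 1ℚ 0<1ℚ
      N₃ , h₃ = eventually-∀< (λ κ n → seq (a κ) n ℚ.≤ 1ℚ) m λ κ κ<m → <⇒eventually≤ {a κ} {1ℝ} (proj₂ (unit κ κ<m))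
      N₄ , h₄ = eventually-∀< (λ κ n → ∀ n′ → n ℕ.≤ n′ → ℚ.∣ seq (a κ) n′ ℚ.- seq (a κ) n ∣ ℚ.≤ ν) m
                  λ κ κ<m → let N , h = cauchy (a κ) ν 0<ν in
                  N , λ n N≤n n′ n≤n′ → h n′ n (ℕ.≤-trans N≤n n≤n′) N≤n
      M = (N₁ ℕ.⊔ N₂) ℕ.⊔ (N₃ ℕ.⊔ N₄)
  in M , record
    { monotone = h₁ M (ℕ.≤-trans (ℕ.m≤m⊔n N₁ N₂) (ℕ.m≤m⊔n (N₁ ℕ.⊔ N₂) (N₃ ℕ.⊔ N₄)))
    ; lower    = h₂ M (ℕ.≤-trans (ℕ.m≤n⊔m N₁ N₂) (ℕ.m≤m⊔n (N₁ ℕ.⊔ N₂) (N₃ ℕ.⊔ N₄)))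
    ; upper    = h₃ M (ℕ.≤-trans (ℕ.m≤m⊔n N₃ N₄) (ℕ.m≤n⊔m (N₁ ℕ.⊔ N₂) (N₃ ℕ.⊔ N₄)))
    ; settled  = h₄ M (ℕ.≤-trans (ℕ.m≤n⊔m N₃ N₄) (ℕ.m≤n⊔m (N₁ ℕ.⊔ N₂) (N₃ ℕ.⊔ N₄)))
    }
  where
  a : ℕ → ℝ
  a = extend (point A)

  unit : ∀ κ → κ ℕ.< m → InUnitInterval (a κ)
  unit κ κ<m = subst InUnitInterval (sym (extend-< (point A) κ<m)) (inUnit A (Fin.fromℕ< κ<m))

  increasing′ : ∀ κ → κ ℕ.< m → ∀ κ′ → κ′ ℕ.< m → κ ℕ.< κ′ → a κ < a κ′
  increasing′ κ κ<m κ′ κ′<m κ<κ′ = subst₂ _<_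
    (sym (extend-< (point A) κ<m)) (sym (extend-< (point A) κ′<m))
    (increasing A _ _ (subst₂ ℕ._<_ (sym (Fin.toℕ-fromℕ< κ<m)) (sym (Fin.toℕ-fromℕ< κ′<m)) κ<κ′))

  ordered : ∀ κ → κ ℕ.< m → ∀ κ′ → κ′ ℕ.< m →
    Eventually (λ n → κ ℕ.≤ κ′ → seq (a κ) n ℚ.≤ seq (a κ′) n)
  ordered κ κ<m κ′ κ′<m with κ ℕ.<? κ′
  ... | yes κ<κ′ = eventually-map (λ _ le _ → le) (<⇒eventually≤ {a κ} {a κ′} (increasing′ κ κ<m κ′ κ′<m κ<κ′))
  ... | no κ≮κ′  = 0 , λ n _ κ≤κ′ → ℚ.≤-reflexive (cong (λ i → seq (a i) n) (ℕ.≤-antisym κ≤κ′ (ℕ.≮⇒≥ κ≮κ′)))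

-- Beyond `n` each of the two points drifts by at most ν, whence ν + ν.
‖‖≤-settled : ∀ {a m ν n} → GoodIndex a m ν n → ∀ {κ κ′} z t → κ ℕ.< m → κ′ ℕ.< m → z ≃ a κ - a κ′ →
  ℚ.∣ seq (a κ) n ℚ.- seq (a κ′) n ∣ ℚ.+ (ν ℚ.+ ν) ℚ.≤ t → ‖ z ‖ ≤ fromℚ t
‖‖≤-settled {a} {m} {ν} {n} good {κ} {κ′} z _ κ<m κ′<m z≃ = ‖‖≤-of-≃ {z} {a κ - a κ′} z≃
  (n , λ n′ n≤n′ → begin
    ℚ.∣ seq (a κ) n′ ℚ.- seq (a κ′) n′ ∣
      ≡⟨ cong ℚ.∣_∣ (solve 4 (λ p q p₀ q₀ → p :- q := (p₀ :- q₀) :+ ((p :- p₀) :- (q :- q₀))) refl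
           (seq (a κ) n′) (seq (a κ′) n′) (seq (a κ) n) (seq (a κ′) n)) ⟩
    ℚ.∣ d ℚ.+ ((seq (a κ) n′ ℚ.- seq (a κ) n) ℚ.- (seq (a κ′) n′ ℚ.- seq (a κ′) n)) ∣
      ≤⟨ ℚ.∣p+q∣≤∣p∣+∣q∣ d _ ⟩
    ℚ.∣ d ∣ ℚ.+ ℚ.∣ (seq (a κ) n′ ℚ.- seq (a κ) n) ℚ.- (seq (a κ′) n′ ℚ.- seq (a κ′) n) ∣
      ≤⟨ ℚ.+-monoʳ-≤ ℚ.∣ d ∣ (ℚ.≤-trans
           (ℚ.∣p-q∣≤∣p∣+∣q∣ (seq (a κ) n′ ℚ.- seq (a κ) n) (seq (a κ′) n′ ℚ.- seq (a κ′) n))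
           (ℚ.+-mono-≤ (settled κ κ<m n′ n≤n′) (settled κ′ κ′<m n′ n≤n′))) ⟩
    ℚ.∣ d ∣ ℚ.+ (ν ℚ.+ ν) ∎)
  where
  open GoodIndex good
  open ℚ.≤-Reasoning
  d : ℚ
  d = seq (a κ) n ℚ.- seq (a κ′) n

sameQuotient⇒< : ∀ c c′ B .{{_ : NonZero B}} → c / B ≡ c′ / B → c ℕ.< c′ ℕ.+ B
sameQuotient⇒< c c′ B e = begin-strict
  c                        ≡⟨ ℕ.m≡m%n+[m/n]*n c B ⟩
  c % B ℕ.+ c / B ℕ.* B    <⟨ ℕ.+-monoˡ-< (c / B ℕ.* B) (ℕ.m%n<n c B) ⟩
  B ℕ.+ c / B ℕ.* B        ≡⟨ cong (λ q → B ℕ.+ q ℕ.* B) e ⟩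
  B ℕ.+ c′ / B ℕ.* B       ≤⟨ ℕ.+-monoʳ-≤ B (ℕ.m/n*n≤m c′ B) ⟩
  B ℕ.+ c′                 ≡⟨ ℕ.+-comm B c′ ⟩
  c′ ℕ.+ B                 ∎
  where open ℕ.≤-Reasoning

-- Equal quotients put the two floors strictly less than `B` apart; the strictness absorbs the
-- fractional part of `q`, so the bound is `B` and not `B` + 1.
sameCell⇒≤ : ∀ M B .{{_ : NonZero B}} {q r} → 0ℚ ℚ.≤ r → q ℚ.≤ ι (suc M) →
  boundedFloor M q / B ≡ boundedFloor M r / B → q ℚ.≤ r ℚ.+ ι B
sameCell⇒≤ M B {q} {r} 0≤r q≤ e = begin
  q                                 ≤⟨ ≤boundedFloor+1 M q≤ ⟩
  ι (suc (boundedFloor M q))        ≤⟨ ι-mono (sameQuotient⇒< (boundedFloor M q) (boundedFloor M r) B e) ⟩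
  ι (boundedFloor M r ℕ.+ B)        ≡⟨ ι-+ (boundedFloor M r) B ⟩
  ι (boundedFloor M r) ℚ.+ ι B      ≤⟨ ℚ.+-monoˡ-≤ (ι B) (boundedFloor≤ M 0≤r) ⟩
  r ℚ.+ ι B                         ∎
  where open ℚ.≤-Reasoning

-- Many pairs with a common small difference

-- Chosen so that the block indices in a set of at most kN points do not exceed N/(4p).
blockLength : ℕ → ℕ → ℕ
blockLength p k = 4 ℕ.* p ℕ.* k

-- Two offsets in a block and a word of `L` letters from an alphabet of s + 1.
shapeCount : ℕ → ℕ → ℕ
shapeCount s L = L ℕ.* L ℕ.* suc s ℕ.^ L

module SimilarPairs {x s K γ N} (F : FewGapSubset x s K γ N) .{{_ : NonZero N}}
  (p k : ℕ) .{{_ : NonZero p}} .{{_ : NonZero k}}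
  (many : N ℕ.≤ p ℕ.* suc (card (FewGapSubset.J F)))
  (short : FewGapSubset.size F ℕ.≤ k ℕ.* N)
  (8p≤N : 8 ℕ.* p ℕ.≤ N)
  where

  open FewGapSubset F renaming (size to m)

  -- `B` cells of width 1/N are merged into one. Approximants range over an interval of length 2, so
  -- merged cells have index at most 2N/B ≤ N/(4p), matching the bound for blocks.
  B L W : ℕ
  B = 8 ℕ.* p
  L = blockLength p k
  W = shapeCount s L

  instance
    B≢0 : NonZero B
    B≢0 = ℕ.m*n≢0 8 p
    L≢0 : NonZero L
    L≢0 = ℕ.m*n≢0 (4 ℕ.* p) k {{ℕ.m*n≢0 4 p}}

  a : ℕ → ℝ
  a = extend (point A)

  ν : ℚ
  ν = + 1 ℚ./ N

  n : ℕ
  n = proj₁ (goodIndex A ν (1/-pos N))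

  good : GoodIndex a m ν n
  good = proj₂ (goodIndex A ν (1/-pos N))

  open GoodIndex good

  -- The position in A of a chosen term, with junk value 0 outside J.
  position : Fin N → ℕ
  position j with j ∈? J
  ... | yes j∈J = toℕ (proj₁ (contained j j∈J))
  ... | no _    = 0

  position-spec : ∀ {j} → j ∈ₛ J → position j ℕ.< m × x (toℕ j) ≃ a (position j)
  position-spec {j} j∈J with j ∈? J
  ... | yes j∈J′ = let k , x≃ = contained j j∈J′ in
    Fin.toℕ<n k , subst (x (toℕ j) ≃_) (sym (extend-toℕ (point A) k)) x≃
  ... | no j∉J = contradiction j∈J j∉J

  -- The shift by 1 carries the range [-1,1] of the approximants to [0,2N], where `boundedFloor` is
  -- a genuine floor.
  scaled : ℕ → ℚ
  scaled κ = ι N ℚ.* (seq (a κ) n ℚ.+ 1ℚ)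

  cell : ℕ → ℕ
  cell κ = boundedFloor (2 ℕ.* N) (scaled κ)

  scaled-mono : ∀ {κ κ′} → κ ℕ.< m → κ′ ℕ.< m → κ ℕ.≤ κ′ → scaled κ ℚ.≤ scaled κ′
  scaled-mono κ<m κ′<m κ≤κ′ = ℚ.*-monoˡ-≤-nonNeg (ι N) (ℚ.+-monoˡ-≤ 1ℚ (monotone _ κ<m _ κ′<m κ≤κ′))

  0≤scaled : ∀ {κ} → κ ℕ.< m → 0ℚ ℚ.≤ scaled κ
  0≤scaled {κ} κ<m = subst (ℚ._≤ scaled κ) (ℚ.*-zeroʳ (ι N)) (ℚ.*-monoˡ-≤-nonNeg (ι N) (lower κ κ<m))

  scaled≤ : ∀ {κ} → κ ℕ.< m → scaled κ ℚ.≤ ι (suc (2 ℕ.* N))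
  scaled≤ {κ} κ<m = begin
    scaled κ              ≤⟨ ℚ.*-monoˡ-≤-nonNeg (ι N) (ℚ.+-monoˡ-≤ 1ℚ (upper κ κ<m)) ⟩
    ι N ℚ.* ι 2           ≡⟨ ι-* N 2 ⟨
    ι (N ℕ.* 2)           ≡⟨ cong ι (ℕ.*-comm N 2) ⟩
    ι (2 ℕ.* N)           ≤⟨ ι-mono (ℕ.n≤1+n (2 ℕ.* N)) ⟩
    ι (suc (2 ℕ.* N))     ∎
    where open ℚ.≤-Reasoning

  -- Both summands are monotone, so points with the same key share their block of
  -- L consecutive points of A as well as their cell of length B / N.
  key : ℕ → ℕ
  key κ = κ / L ℕ.+ cell κ / B

  sameKey : ∀ {κ κ′} → κ ℕ.< m → κ′ ℕ.< m → key κ ≡ key κ′ → κ / L ≡ κ′ / L × cell κ / B ≡ cell κ′ / B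
  sameKey {κ} {κ′} κ<m κ′<m e =
    [ (λ κ≤κ′ → ordered κ<m κ′<m κ≤κ′ e)
    , (λ κ′≤κ → let e₁ , e₂ = ordered κ′<m κ<m κ′≤κ (sym e) in sym e₁ , sym e₂)
    ]′ (ℕ.≤-total κ κ′)
    where
    ordered : ∀ {κ κ′} → κ ℕ.< m → κ′ ℕ.< m → κ ℕ.≤ κ′ → key κ ≡ key κ′ →
      κ / L ≡ κ′ / L × cell κ / B ≡ cell κ′ / B
    ordered κ<m κ′<m κ≤κ′ = sameSummands (ℕ./-monoˡ-≤ L κ≤κ′)
      (ℕ./-monoˡ-≤ B (boundedFloor-mono (2 ℕ.* N) (scaled-mono κ<m κ′<m κ≤κ′)))

  -- The two ranges add instead of multiplying: at most N/(2p) + 1 keys for roughly N/p chosen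
  -- terms, so about half of the terms collide.
  keys : ℕ
  keys = suc (k ℕ.* N / L ℕ.+ 2 ℕ.* N / B)

  key<keys : ∀ {κ} → κ ℕ.< m → key κ ℕ.< keys
  key<keys {κ} κ<m = ℕ.s≤s (ℕ.+-mono-≤
    (ℕ./-monoˡ-≤ L (ℕ.≤-trans (ℕ.<⇒≤ κ<m) short))
    (ℕ./-monoˡ-≤ B (boundedFloor≤bound (2 ℕ.* N) (scaled κ))))

  holes = pigeonhole-pairs (key ∘ position) keys (elements J) (elements-unique J)
            (λ j∈ → key<keys (proj₁ (position-spec (∈-elements⁻ J j∈))))

  collided : List (Fin N × Fin N)
  collided = proj₁ holes

  record Collided (l l′ : Fin N) : Set where
    field
      bound  : position l ℕ.< m
      bound′ : position l′ ℕ.< m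
      at     : x (toℕ l) ≃ a (position l)
      at′    : x (toℕ l′) ≃ a (position l′)
      l≢l′   : l ≢ l′
      block  : position l / L ≡ position l′ / L
      cell≡  : cell (position l) / B ≡ cell (position l′) / B

  collided⇒ : ∀ {l l′} → (l , l′) ∈ collided → Collided l l′
  collided⇒ ll′∈ =
    let l∈ , l′∈ , l≢l′ , e = proj₁ (proj₂ (proj₂ holes)) ll′∈
        b , at              = position-spec (∈-elements⁻ J l∈)
        b′ , at′            = position-spec (∈-elements⁻ J l′∈)
        block , cell≡       = sameKey b b′ e
    in record { bound = b ; bound′ = b′ ; at = at ; at′ = at′ ; l≢l′ = l≢l′ ; block = block ; cell≡ = cell≡ }

  difference≃ : ∀ {l l′} → Collided l l′ → difference x (l , l′) ≃ a (position l) - a (position l′)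
  difference≃ {l} {l′} c = null-ext
    (λ n → solve 4 (λ x y u v → (x :- u) :- (y :- v) := (x :- y) :- (u :- v)) refl
      (seq (x (toℕ l)) n) (seq (x (toℕ l′)) n) (seq (a (position l)) n) (seq (a (position l′)) n))
    (null-- at at′)
    where open Collided c

  -- In units of 1/N, the shared cell contributes `B` and the drift of the two approximants 1 each.
  norm≤ : ∀ {l l′} → Collided l l′ → ∀ t → ι (B ℕ.+ 2) ℚ.≤ t ℚ.* ι N → ‖ difference x (l , l′) ‖ ≤ fromℚ t
  norm≤ {l} {l′} c t large = ‖‖≤-settled good (difference x (l , l′)) t bound bound′ (difference≃ c)
    (ℚ.*-cancelʳ-≤-pos (ι N) {{ι-pos N}} (ℚ.≤-trans (begin
      (ℚ.∣ u ℚ.- v ∣ ℚ.+ (ν ℚ.+ ν)) ℚ.* ι N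
        ≡⟨ solve 3 (λ d ν N → (d :+ (ν :+ ν)) :* N := N :* d :+ (ν :* N :+ ν :* N)) refl ℚ.∣ u ℚ.- v ∣ ν (ι N) ⟩
      ι N ℚ.* ℚ.∣ u ℚ.- v ∣ ℚ.+ (ν ℚ.* ι N ℚ.+ ν ℚ.* ι N)
        ≡⟨ cong₂ ℚ._+_ scaled-difference (cong₂ ℚ._+_ (/-* 1 N) (/-* 1 N)) ⟩
      ℚ.∣ scaled (position l) ℚ.- scaled (position l′) ∣ ℚ.+ ι 2
        ≤⟨ ℚ.+-monoˡ-≤ (ι 2) (∣-∣≤ {scaled (position l)} {scaled (position l′)}
             (sameCell⇒≤ (2 ℕ.* N) B (0≤scaled bound′) (scaled≤ bound) cell≡)
             (sameCell⇒≤ (2 ℕ.* N) B (0≤scaled bound) (scaled≤ bound′) (sym cell≡))) ⟩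
      ι B ℚ.+ ι 2
        ≡⟨ ι-+ B 2 ⟨
      ι (B ℕ.+ 2) ∎) large))
    where
    open Collided c
    open ℚ.≤-Reasoning
    u v : ℚ
    u = seq (a (position l)) n
    v = seq (a (position l′)) n

    scaled-difference : ι N ℚ.* ℚ.∣ u ℚ.- v ∣ ≡ ℚ.∣ scaled (position l) ℚ.- scaled (position l′) ∣
    scaled-difference = trans (sym (ℚ.∣p*q∣≡∣p∣*∣q∣ (ι N) (u ℚ.- v)))
      (cong ℚ.∣_∣ (solve 4 (λ N u v e → N :* (u :- v) := N :* (u :+ e) :- N :* (v :+ e)) refl (ι N) u v 1ℚ))

  gap : ℕ → Fin (suc s)
  gap = gapIndex A fewGaps

  word : ℕ → Fin (suc s ℕ.^ L)
  word κ = Fin.funToFin {L} λ i → gap (toℕ i ℕ.+ κ / L ℕ.* L)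

  sameWord : ∀ {κ κ′} → word κ ≡ word κ′ → ∀ i → i ℕ.< L →
    toℕ (gap (i ℕ.+ κ / L ℕ.* L)) ≡ toℕ (gap (i ℕ.+ κ′ / L ℕ.* L))
  sameWord {κ} {κ′} e i i<L = cong toℕ (subst (λ j → gap (j ℕ.+ κ / L ℕ.* L) ≡ gap (j ℕ.+ κ′ / L ℕ.* L))
    (Fin.toℕ-fromℕ< i<L)
    (trans (sym (Fin.finToFun-funToFin {L} (λ i → gap (toℕ i ℕ.+ κ / L ℕ.* L)) (Fin.fromℕ< i<L)))
      (trans (cong (λ w → Fin.finToFun {suc s} {L} w (Fin.fromℕ< i<L)) e)
        (Fin.finToFun-funToFin {L} (λ i → gap (toℕ i ℕ.+ κ′ / L ℕ.* L)) (Fin.fromℕ< i<L)))))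

  translated : ∀ {κ κ′} → κ ℕ.< m → κ′ ℕ.< m → κ % L ≡ κ′ % L → word κ ≡ word κ′ →
    a κ - a κ′ ≃ a (κ / L ℕ.* L) - a (κ′ / L ℕ.* L)
  translated {κ} {κ′} κ<m κ′<m r e = subst₂ (λ i i′ → a i - a i′ ≃ a β - a β′) (sym eκ) (sym eκ′)
    (translate a m L (toℕ ∘ gap) (sameGapIndex⇒≃ A fewGaps) β β′ (sameWord {κ} {κ′} e)
      (κ % L) (ℕ.m%n<n κ L) (subst (ℕ._< m) eκ κ<m) (subst (ℕ._< m) eκ′ κ′<m))
    where
    β β′ : ℕ
    β  = κ / L ℕ.* L
    β′ = κ′ / L ℕ.* L
    eκ : κ ≡ κ % L ℕ.+ β
    eκ = ℕ.m≡m%n+[m/n]*n κ L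
    eκ′ : κ′ ≡ κ % L ℕ.+ β′
    eκ′ = trans (ℕ.m≡m%n+[m/n]*n κ′ L) (cong (ℕ._+ β′) (sym r))

  -- One word is enough, since both positions of a collided pair lie in the same block.
  shape : Fin N × Fin N → Fin W
  shape (l , l′) = Fin.combine (Fin.combine (position l mod L) (position l′ mod L)) (word (position l))

  mod-injective : ∀ {κ κ′} → κ mod L ≡ κ′ mod L → κ % L ≡ κ′ % L
  mod-injective {κ} {κ′} e = trans (sym (Fin.toℕ-fromℕ< (ℕ.m%n<n κ L)))
    (trans (cong toℕ e) (Fin.toℕ-fromℕ< (ℕ.m%n<n κ′ L)))

  -- Rewriting (p - p′) - (q - q′) as (p - q) - (p′ - q′) compares positions at equal offsets in two
  -- blocks with equal words. Both brackets equal the difference of the block starts, so they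
  -- cancel.
  sameShape : ∀ {l l′ i i′} → Collided l l′ → Collided i i′ → toℕ (shape (l , l′)) ≡ toℕ (shape (i , i′)) →
    difference x (l , l′) ≃ difference x (i , i′)
  sameShape {l} {l′} {i} {i′} c d e = null-ext
    (λ n → solve 10 (λ x x′ y y′ p p′ q q′ u v →
        (((x :- x′) :- (p :- p′)) :- ((y :- y′) :- (q :- q′))) :+
        (((p :- q) :- (u :- v)) :- ((p′ :- q′) :- (u :- v))) := (x :- x′) :- (y :- y′)) refl
      (seq (x (toℕ l)) n) (seq (x (toℕ l′)) n) (seq (x (toℕ i)) n) (seq (x (toℕ i′)) n)
      (seq (a κ) n) (seq (a κ′) n) (seq (a λ′) n) (seq (a λ″) n)
      (seq (a (κ / L ℕ.* L)) n) (seq (a (λ′ / L ℕ.* L)) n))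
    (null-+ (null-- (difference≃ c) (difference≃ d)) (null-- first second))
    where
    module P = Collided c
    module Q = Collided d
    κ κ′ λ′ λ″ : ℕ
    κ  = position l
    κ′ = position l′
    λ′ = position i
    λ″ = position i′

    fins : Fin.combine (κ mod L) (κ′ mod L) ≡ Fin.combine (λ′ mod L) (λ″ mod L) × word κ ≡ word λ′
    fins = Fin.combine-injective _ _ _ _ (Fin.toℕ-injective e)

    offsets : κ mod L ≡ λ′ mod L × κ′ mod L ≡ λ″ mod L
    offsets = Fin.combine-injective _ _ _ _ (proj₁ fins)

    sameBlock : ∀ {κ κ′} → κ / L ≡ κ′ / L → word κ ≡ word κ′
    sameBlock e = cong (λ b → Fin.funToFin {L} λ i → gap (toℕ i ℕ.+ b ℕ.* L)) e

    first : a κ - a λ′ ≃ a (κ / L ℕ.* L) - a (λ′ / L ℕ.* L)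
    first = translated P.bound Q.bound (mod-injective (proj₁ offsets)) (proj₂ fins)

    second : a κ′ - a λ″ ≃ a (κ / L ℕ.* L) - a (λ′ / L ℕ.* L)
    second = subst₂ (λ b b′ → a κ′ - a λ″ ≃ a (b ℕ.* L) - a (b′ ℕ.* L)) (sym P.block) (sym Q.block)
      (translated P.bound′ Q.bound′ (mod-injective (proj₂ offsets))
        (trans (sym (sameBlock P.block)) (trans (proj₂ fins) (sameBlock Q.block))))

  similar : ∃[ c ] length collided ℕ.≤ W ℕ.* length (class (toℕ ∘ shape) c collided)
  similar = largeClass (toℕ ∘ shape) W collided (λ {q} _ → Fin.toℕ<n (shape q))

  pairs : List (Fin N × Fin N)
  pairs = class (toℕ ∘ shape) (proj₁ similar) collided

  pairs-unique : Unique pairs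
  pairs-unique = Unique.filter⁺ (λ q → toℕ (shape q) ℕ.≟ proj₁ similar) (proj₁ (proj₂ holes))

  pair⇒ : ∀ {q} → q ∈ pairs → Collided (proj₁ q) (proj₂ q) × toℕ (shape q) ≡ proj₁ similar
  pair⇒ q∈ = let q∈′ , e = ∈-filter⁻ (λ q → toℕ (shape q) ℕ.≟ proj₁ similar) {xs = collided} q∈
             in collided⇒ q∈′ , e

  pairs-distinct : ∀ {q} → q ∈ pairs → proj₁ q ≢ proj₂ q
  pairs-distinct q∈ = Collided.l≢l′ (proj₁ (pair⇒ q∈))

  pairs-≃ : ∀ {q r} → q ∈ pairs → r ∈ pairs → difference x q ≃ difference x r
  pairs-≃ q∈ r∈ = let c , e = pair⇒ q∈ ; d , f = pair⇒ r∈ in sameShape c d (trans e (sym f))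

  pairs-close : ∀ {q} → q ∈ pairs → ∀ t → ι (B ℕ.+ 2) ℚ.≤ t ℚ.* ι N → ‖ difference x q ‖ ≤ fromℚ t
  pairs-close q∈ = norm≤ (proj₁ (pair⇒ q∈))

  4p*blocks≤N : 4 ℕ.* p ℕ.* (k ℕ.* N / L) ℕ.≤ N
  4p*blocks≤N = ℕ.*-cancelʳ-≤ _ _ k (begin
    4 ℕ.* p ℕ.* (k ℕ.* N / L) ℕ.* k     ≡⟨ regroup p (k ℕ.* N / L) k ⟩
    k ℕ.* N / L ℕ.* L                   ≤⟨ ℕ.m/n*n≤m (k ℕ.* N) L ⟩
    k ℕ.* N                             ≡⟨ ℕ.*-comm k N ⟩
    N ℕ.* k                             ∎)
    where
    open ℕ.≤-Reasoning
    regroup : ∀ p b k → 4 ℕ.* p ℕ.* b ℕ.* k ≡ b ℕ.* (4 ℕ.* p ℕ.* k)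
    regroup = solve-∀

  4p*cells≤N : 4 ℕ.* p ℕ.* (2 ℕ.* N / B) ℕ.≤ N
  4p*cells≤N = ℕ.*-cancelʳ-≤ _ _ 2 (begin
    4 ℕ.* p ℕ.* (2 ℕ.* N / B) ℕ.* 2     ≡⟨ regroup p (2 ℕ.* N / B) ⟩
    2 ℕ.* N / B ℕ.* B                   ≤⟨ ℕ.m/n*n≤m (2 ℕ.* N) B ⟩
    2 ℕ.* N                             ≡⟨ ℕ.*-comm 2 N ⟩
    N ℕ.* 2                             ∎)
    where
    open ℕ.≤-Reasoning
    regroup : ∀ p b → 4 ℕ.* p ℕ.* b ℕ.* 2 ≡ b ℕ.* (8 ℕ.* p)
    regroup = solve-∀

  -- Of 4N, blocks and merged cells use at most N each. The last N pays for the two additive units,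
  -- one in `keys` and one in `many`, which cost 8p together. The remaining N is left to the
  -- collided pairs, of which one shape keeps at least the fraction 1/W.
  pairs-many : N ℕ.≤ 4 ℕ.* p ℕ.* (W ℕ.* length pairs)
  pairs-many = ℕ.≤-trans (ℕ.+-cancelʳ-≤ (3 ℕ.* N) _ _ (begin
    N ℕ.+ 3 ℕ.* N                                     ≡⟨⟩
    4 ℕ.* N                                           ≤⟨ ℕ.*-monoʳ-≤ 4 many ⟩
    4 ℕ.* (p ℕ.* suc (card J))                        ≤⟨ ℕ.*-monoʳ-≤ 4 (ℕ.*-monoʳ-≤ p (ℕ.s≤s card≤)) ⟩
    4 ℕ.* (p ℕ.* suc (R ℕ.+ keys))                    ≡⟨ regroup p R b c ⟩
    4 ℕ.* p ℕ.* R ℕ.+ (4 ℕ.* p ℕ.* b ℕ.+ (4 ℕ.* p ℕ.* c ℕ.+ 8 ℕ.* p))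
      ≤⟨ ℕ.+-monoʳ-≤ (4 ℕ.* p ℕ.* R) (ℕ.+-mono-≤ 4p*blocks≤N (ℕ.+-mono-≤ 4p*cells≤N 8p≤N)) ⟩
    4 ℕ.* p ℕ.* R ℕ.+ (N ℕ.+ (N ℕ.+ N))               ≡⟨ cong (λ e → 4 ℕ.* p ℕ.* R ℕ.+ (N ℕ.+ (N ℕ.+ e))) (ℕ.+-identityʳ N) ⟨
    4 ℕ.* p ℕ.* R ℕ.+ 3 ℕ.* N                         ∎))
    (ℕ.*-monoʳ-≤ (4 ℕ.* p) (proj₂ similar))
    where
    open ℕ.≤-Reasoning
    regroup : ∀ p R b c → 4 ℕ.* (p ℕ.* suc (R ℕ.+ suc (b ℕ.+ c))) ≡
      4 ℕ.* p ℕ.* R ℕ.+ (4 ℕ.* p ℕ.* b ℕ.+ (4 ℕ.* p ℕ.* c ℕ.+ 8 ℕ.* p))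
    regroup = solve-∀
    R b c : ℕ
    R = length collided
    b = k ℕ.* N / L
    c = 2 ℕ.* N / B
    card≤ : card J ℕ.≤ R ℕ.+ keys
    card≤ = subst (ℕ._≤ R ℕ.+ keys) (length-elements J) (proj₂ (proj₂ (proj₂ holes)))

-- The jump of the count and the contradiction

rescale-cancel : ∀ D N .{{_ : NonZero D}} .{{_ : NonZero N}} e →
  ι (e ℕ.* D) ℚ.* (+ 1 ℚ./ D) ℚ.* (+ 1 ℚ./ N) ℚ.* ι N ≡ ι e
rescale-cancel D N e = trans (cong (λ t → t ℚ.* δ ℚ.* ν ℚ.* ι N) (ι-* e D)) (trans
  (solve 5 (λ e D δ ν N → e :* D :* δ :* ν :* N := e :* (δ :* D) :* (ν :* N)) refl (ι e) (ι D) δ ν (ι N))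
  (trans (cong₂ (λ u v → ι e ℚ.* u ℚ.* v) (/-* 1 D) (/-* 1 N))
    (trans (ℚ.*-identityʳ _) (ℚ.*-identityʳ (ι e)))))
  where
  δ ν : ℚ
  δ = + 1 ℚ./ D
  ν = + 1 ℚ./ N

module CommonDifference {x : ℕ → ℝ} {D N : ℕ} .{{_ : NonZero D}} .{{_ : NonZero N}} (pairs : List (Fin N × Fin N))
  (pairs-unique : Unique pairs) (pairs-distinct : ∀ {q} → q ∈ pairs → proj₁ q ≢ proj₂ q)
  (pairs-≃ : ∀ {q r} → q ∈ pairs → r ∈ pairs → difference x q ≃ difference x r)
  where

  radius : ℕ → ℝ
  radius i = multiple D i * fromℚ (+ 1 ℚ./ N)

  radius-mono : ∀ {z i} → ‖ z ‖ ≤ radius i → ‖ z ‖ ≤ radius (suc i)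
  radius-mono {z} {i} le = ≤-mono-fromℚ {‖ z ‖} le
    (ℚ.*-monoʳ-≤-nonNeg (+ 1 ℚ./ N) {{ℚ.nonNegative (ℚ.<⇒≤ (1/-pos N))}}
      (ℚ.*-monoʳ-≤-nonNeg (+ 1 ℚ./ D) {{ℚ.nonNegative (ℚ.<⇒≤ (1/-pos D))}} (ι-mono (ℕ.n≤1+n i))))

  pairs-at-radius : ∀ {q} → q ∈ pairs → ∀ i → ‖ difference x q ‖ ≤ radius i →
    ∀ {r} → r ∈ pairs → ClosePair x (multiple D i) N r
  pairs-at-radius {q} q∈ i le {r} r∈ = pairs-distinct r∈ ,
    ‖‖≤-resp-≃ {difference x q} {difference x r} (radius i) (pairs-≃ q∈ r∈) le

  -- The count jumps by length pairs when the radius passes the common distance of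
  -- the pairs, whereas pair correlation allows an increase of at most 6N/D.
  few-at-0 : CountBounds x D 0 N → ∀ {q} → q ∈ pairs → ‖ difference x q ‖ ≤ radius 0 →
    ¬ ¬ (length pairs ℕ.* D ℕ.≤ 6 ℕ.* N)
  few-at-0 counts q∈ le k = ¬¬-count (ClosePair x (multiple D 0) N) λ
    { (c , cs@(as , u , char , len)) → k (begin
      length pairs ℕ.* D  ≤⟨ ℕ.*-monoˡ-≤ D (subst (length pairs ℕ.≤_) len (unique-⊆⇒length-≤ pairs-unique
        (λ {r} r∈ → Equivalence.from (char r) (pairs-at-radius q∈ 0 le r∈)))) ⟩
      c ℕ.* D             ≤⟨ proj₁ (counts c cs) ⟩
      2 ℕ.* N             ≤⟨ ℕ.*-monoˡ-≤ N (ℕ.m≤m+n 2 4) ⟩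
      6 ℕ.* N             ∎) }
    where open ℕ.≤-Reasoning

  few-at-suc : ∀ i → CountBounds x D i N → CountBounds x D (suc i) N → ∀ {q} → q ∈ pairs →
    ¬ ‖ difference x q ‖ ≤ radius i → ‖ difference x q ‖ ≤ radius (suc i) →
    ¬ ¬ (length pairs ℕ.* D ℕ.≤ 6 ℕ.* N)
  few-at-suc i counts counts⁺ {q} q∈ far le k =
    ¬¬-count (ClosePair x (multiple D i) N) λ
    { (c , cs@(as , u , char , len)) → ¬¬-count (ClosePair x (multiple D (suc i)) N) λ
    { (c⁺ , cs⁺@(as⁺ , u⁺ , char⁺ , len⁺)) →
      -- All of `pairs` share the distance of `q`, so none is counted at radius `i` and every one is
      -- at the next radius, together with everything counted before.
      let disjoint : Disjoint pairs as
          disjoint = λ { {r} (r∈ , r∈as) → far (‖‖≤-resp-≃ {difference x r} {difference x q} (radius i)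
            (pairs-≃ r∈ q∈) (proj₂ (Equivalence.to (char r) r∈as))) }
          included : ∀ {r} → r ∈ pairs ++ as → r ∈ as⁺
          included = λ {r} r∈ → Equivalence.from (char⁺ r)
            ([ pairs-at-radius q∈ (suc i) le
             , (λ r∈as → let r≢ , rle = Equivalence.to (char r) r∈as in
                 r≢ , radius-mono {difference x r} {i} rle)
             ]′ (∈-++⁻ pairs r∈))
          jump : length pairs ℕ.+ c ℕ.≤ c⁺
          jump = subst₂ ℕ._≤_ (trans (List.length-++ pairs) (cong (length pairs ℕ.+_) len)) len⁺
            (unique-⊆⇒length-≤ (Unique.++⁺ pairs-unique u disjoint) included)
      in k (arithmetic c c⁺ jump (proj₂ (counts c cs)) (proj₁ (counts⁺ c⁺ cs⁺))) } }
    where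
    open ℕ.≤-Reasoning
    regroup : ∀ i N → (2 ℕ.* suc i ℕ.+ 2) ℕ.* N ≡ 2 ℕ.* i ℕ.* N ℕ.+ 4 ℕ.* N
    regroup = solve-∀
    regroup′ : ∀ d N → (d ℕ.+ 2 ℕ.* N) ℕ.+ 4 ℕ.* N ≡ 6 ℕ.* N ℕ.+ d
    regroup′ = solve-∀
    -- The 6 is the upper constant 2(i + 1) + 2 less the lower constant 2i - 2.
    arithmetic : ∀ c c⁺ → length pairs ℕ.+ c ℕ.≤ c⁺ → 2 ℕ.* i ℕ.* N ℕ.≤ c ℕ.* D ℕ.+ 2 ℕ.* N →
      c⁺ ℕ.* D ℕ.≤ (2 ℕ.* suc i ℕ.+ 2) ℕ.* N → length pairs ℕ.* D ℕ.≤ 6 ℕ.* N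
    arithmetic c c⁺ jump lower upper = ℕ.+-cancelʳ-≤ (c ℕ.* D) _ _ (begin
      length pairs ℕ.* D ℕ.+ c ℕ.* D          ≡⟨ ℕ.*-distribʳ-+ D (length pairs) c ⟨
      (length pairs ℕ.+ c) ℕ.* D              ≤⟨ ℕ.*-monoˡ-≤ D jump ⟩
      c⁺ ℕ.* D                                ≤⟨ upper ⟩
      (2 ℕ.* suc i ℕ.+ 2) ℕ.* N               ≡⟨ regroup i N ⟩
      2 ℕ.* i ℕ.* N ℕ.+ 4 ℕ.* N               ≤⟨ ℕ.+-monoˡ-≤ (4 ℕ.* N) lower ⟩
      (c ℕ.* D ℕ.+ 2 ℕ.* N) ℕ.+ 4 ℕ.* N       ≡⟨ regroup′ (c ℕ.* D) N ⟩
      6 ℕ.* N ℕ.+ c ℕ.* D                     ∎)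

  few : ∀ T → (∀ i → i ℕ.< suc T → CountBounds x D i N) →
    (∀ {q} → q ∈ pairs → ‖ difference x q ‖ ≤ radius T) → ¬ ¬ (length pairs ℕ.* D ℕ.≤ 6 ℕ.* N)
  few T counts close k = byCases pairs refl
    where
    byCases : ∀ qs → ¬ qs ≡ pairs
    byCases [] refl = k ℕ.z≤n
    byCases (q ∷ qs) refl = firstTrue (λ i → ‖ difference x q ‖ ≤ radius i) T (close (here refl)) λ where
      (inj₁ le) → few-at-0 (counts 0 (ℕ.s≤s ℕ.z≤n)) (here refl) le k
      (inj₂ (i , i<T , far , le)) →
        few-at-suc i (counts i (ℕ.m≤n⇒m≤1+n i<T)) (counts (suc i) (ℕ.s≤s i<T)) (here refl) far le k

-- At radius 1/meshDenominator the increase 6N/D allowed for the count is below the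
-- number of similar pairs, at least N/(4pW).
meshDenominator : ℕ → ℕ → ℕ → ℕ
meshDenominator s p k = suc (24 ℕ.* (p ℕ.* shapeCount s (blockLength p k)))

countBounds-fail : ∀ {x s K γ N} (F : FewGapSubset x s K γ N) .{{_ : NonZero N}}
  (p k : ℕ) .{{_ : NonZero p}} .{{_ : NonZero k}} →
  N ℕ.≤ p ℕ.* suc (card (FewGapSubset.J F)) → FewGapSubset.size F ℕ.≤ k ℕ.* N → 8 ℕ.* p ℕ.≤ N →
  let D = meshDenominator s p k in
  ¬ (∀ i → i ℕ.< suc ((8 ℕ.* p ℕ.+ 2) ℕ.* D) → CountBounds x D i N)
countBounds-fail {x} {s} {N = N} F p k many short 8p≤N counts =
  few T counts
    (λ q∈ → pairs-close q∈ (ι T ℚ.* (+ 1 ℚ./ D) ℚ.* (+ 1 ℚ./ N))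
      (ℚ.≤-reflexive (sym (rescale-cancel D N (8 ℕ.* p ℕ.+ 2)))))
    λ le → contradiction (ℕ.≤-trans le (begin
      6 ℕ.* N                                     ≤⟨ ℕ.*-monoʳ-≤ 6 pairs-many ⟩
      6 ℕ.* (4 ℕ.* p ℕ.* (W ℕ.* length pairs))    ≡⟨ regroup p W (length pairs) ⟩
      length pairs ℕ.* (24 ℕ.* (p ℕ.* W))         ∎))
      -- Strict because `D` exceeds 24pW by one and `pairs` is non-empty.
      (ℕ.<⇒≱ (ℕ.*-monoʳ-< (length pairs) {{nonEmpty}} ℕ.≤-refl))
  where
  open SimilarPairs F p k many short 8p≤N
  D T : ℕ
  D = meshDenominator s p k
  -- Makes the last radius exactly (8p + 2)/N, the bound on the common distance.
  T = (8 ℕ.* p ℕ.+ 2) ℕ.* D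
  open CommonDifference {x} {D} pairs pairs-unique pairs-distinct pairs-≃
  open ℕ.≤-Reasoning

  regroup : ∀ p W l → 6 ℕ.* (4 ℕ.* p ℕ.* (W ℕ.* l)) ≡ l ℕ.* (24 ℕ.* (p ℕ.* W))
  regroup = solve-∀

  nonEmpty : NonZero (length pairs)
  nonEmpty = ℕ.≢-nonZero λ empty → ℕ.≢-nonZero⁻¹ N (ℕ.n≤0⇒n≡0 (begin
    N                                     ≤⟨ pairs-many ⟩
    4 ℕ.* p ℕ.* (W ℕ.* length pairs)      ≡⟨ cong (λ l → 4 ℕ.* p ℕ.* (W ℕ.* l)) empty ⟩
    4 ℕ.* p ℕ.* (W ℕ.* 0)                 ≡⟨ cong (4 ℕ.* p ℕ.*_) (ℕ.*-zeroʳ W) ⟩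
    4 ℕ.* p ℕ.* 0                         ≡⟨ ℕ.*-zeroʳ (4 ℕ.* p) ⟩
    0                                     ∎))

theorem1 : (x : ℕ → ℝ) → (∀ n → InUnitInterval (x n)) →
    (Σ[ s ∈ ℕ ] Σ[ K ∈ ℝ ] Σ[ γ ∈ ℝ ] (0ℝ < K × 0ℝ < γ ×
    (∀ n → ∃[ N ] (n ≤ₙ N × FewGapSubset x s K γ N)))) →
    ¬ PoissonianPairCorrelations x
theorem1 x _ (s , K , γ , _ , 0<γ , frequently) ppc =
  let p-1 , dense = positive⇒linearBound {γ} 0<γ
      k-1 , short = realMultiple⇒linearBound K
      p = suc p-1
      k = suc k-1
      D = meshDenominator s p k
      -- The number of radii does not involve `N`, so one threshold serves all of them and `N` can
      -- be chosen afterwards.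
      N₀ , counts = eventually-∀< (CountBounds x D) (suc ((8 ℕ.* p ℕ.+ 2) ℕ.* D))
                      λ i _ → poissonian⇒countBounds {x} ppc D i
      N , N₀≤N , F = frequently (N₀ ℕ.⊔ 8 ℕ.* p)
      8p≤N = ℕ.m⊔n≤o⇒n≤o N₀ (8 ℕ.* p) N₀≤N
      instance
        N≢0 : NonZero N
        N≢0 = ℕ.>-nonZero (ℕ.≤-trans (ℕ.s≤s ℕ.z≤n) 8p≤N)
  in countBounds-fail F p k (dense N _ (FewGapSubset.J-large F)) (short N _ (FewGapSubset.size≤KN F)) 8p≤N
       (counts N (ℕ.m⊔n≤o⇒m≤o N₀ (8 ℕ.* p) N₀≤N))
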